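{- Let $k\ge0$ and $m\ge1$ be integers and let $p(x)\in\mathbb{Q}[x]$ be a nonzero polynomial of degree $d<m+k$. For $n\in\mathbb{Z}$ put $$S_n(m)=\frac1m\sum_{s=1}^{m-1}\frac{p(\xi^s)\,\xi^{ns}}{(1-\xi^s)^k},\qquad \xi=e^{2\pi i/m}.$$ Then $$S_0(m)=p(0)-\frac1m\sum_{\substack{i,j\ge0\\ i+j\le k}}\frac{(-1)^iD^ip(1)}{i!}\,f^{(m)}_j(1).$$ Further, if $p(1/x)=(-1)^{ -\delta}x^{ -d}p(x)$ for some integer $\delta$, then for every integer $n$ with $1\le n<m+k-d$, $$S_n(m)=-\frac1m\sum_{\substack{i,j\ge0\\ i+j\le k}}(-1)^{k-i-j}\,\frac{(-1)^iD^ip(1)}{i!}\,f^{(m)}_j(1)\binom{n-1}{k-i-j}.$$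
   Context: $D^ip(1)$ is the $i$-th derivative of $p$ evaluated at $1$. For $m\ge1$, $\Psi_m(x)=1+x+\cdots+x^{m-1}$, and $f^{(m)}_j(x)=\big(-\tfrac1m x\Psi_m'(x)\big)^j\ \mathrm{rem}\ \Psi_m(x)$ for $j\ge1$, $f^{(m)}_0(x)=1$, where $f\ \mathrm{rem}\ q$ denotes the remainder of $f$ on Euclidean division by $q$. -}

module Defs where

open import Level using (Level; _⊔_) renaming (suc to lsuc)
open import Data.Nat.Base as ℕ using (ℕ; zero; suc; pred; z≤n; s≤s; _!)
import Data.Nat.Properties as ℕ
open import Data.Integer.Base as ℤ using (ℤ; +_; -[1+_])
open import Data.Rational.Base
  using (ℚ; 0ℚ; 1ℚ; _+_; _*_; _-_; -_; _/_; 1/_; _÷_; NonZero; ≢-nonZero)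
import Data.Rational.Properties as ℚ
open import Data.Fin.Base using (Fin; toℕ)
open import Data.Fin.Properties using (toℕ<n)
open import Data.List.Base using (List; []; _∷_; map; foldr; replicate)
open import Data.Product.Base using (∃; _×_; _,_; proj₁)
open import Algebra.Bundles using (CommutativeRing; Semiring)
open import Algebra.Apartness.Bundles using (HeytingField)
open import Algebra.Morphism.Structures using (module RingMorphisms)
import Algebra.Apartness.Properties.HeytingCommutativeRing as HCRProperties
import Algebra.Definitions.RawSemiring as RawSemiringDefs
import Algebra.Properties.Monoid.Sum as MonoidSum
open import Relation.Binary.PropositionalEquality
  using (_≡_; _≢_; refl; sym; trans; cong; cong₂; subst; module ≡-Reasoning)

open import Algebra.Definitions.RawSemiring ℚ.+-*-rawSemiring public using (_^_)
open MonoidSum ℚ.+-0-monoid using (sum⁺-syntax)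

infixr 8 _^ℤ_
_^ℤ_ : (x : ℚ) .{{_ : NonZero x}} → ℤ → ℚ
x ^ℤ (+ n)    = x ^ n
x ^ℤ -[1+ n ] = (1/ x) ^ suc n

infixl 7 _/!_
_/!_ : ℚ → ℕ → ℚ
x /! i = x * (+ 1 / (i !)) {{i ℕ.!≢0}}

-- The sum of F i j over all i, j ≥ 0 with i + j ≤ k.
∑₊≤ : ℕ → (ℕ → ℕ → ℚ) → ℚ
∑₊≤ k F = ∑[ i ≤ k ] (∑[ j ≤ k ℕ.∸ toℕ i ] F (toℕ i) (toℕ j))

-- a₀ ∷ a₁ ∷ … ∷ [] is a₀ + a₁x + …; trailing zeros are allowed.
Poly : Set
Poly = List ℚ

coeff : Poly → ℕ → ℚ
coeff []      _       = 0ℚ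
coeff (a ∷ f) zero    = a
coeff (a ∷ f) (suc j) = coeff f j

infix 4 _≈ₚ_
_≈ₚ_ : Poly → Poly → Set
f ≈ₚ g = ∀ j → coeff f j ≡ coeff g j

-- In particular a polynomial having a degree is nonzero.
record HasDegree (f : Poly) (e : ℕ) : Set where
  field
    leading≢0 : coeff f e ≢ 0ℚ
    above≡0   : ∀ {j} → e ℕ.< j → coeff f j ≡ 0ℚ

eval : Poly → ℚ → ℚ
eval f x = foldr (λ a r → a + x * r) 0ℚ f

infixl 6 _+ₚ_
_+ₚ_ : Poly → Poly → Poly
[]      +ₚ g       = g
(a ∷ f) +ₚ []      = a ∷ f
(a ∷ f) +ₚ (b ∷ g) = a + b ∷ f +ₚ g

infixl 7 _·ₚ_
_·ₚ_ : ℚ → Poly → Poly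
c ·ₚ f = map (c *_) f

infixl 7 _*ₚ_
_*ₚ_ : Poly → Poly → Poly
[]      *ₚ g = []
(a ∷ f) *ₚ g = a ·ₚ g +ₚ (0ℚ ∷ f *ₚ g)

infixr 8 _^ₚ_
_^ₚ_ : Poly → ℕ → Poly
f ^ₚ zero  = 1ℚ ∷ []
f ^ₚ suc j = f *ₚ f ^ₚ j

X : Poly
X = 0ℚ ∷ 1ℚ ∷ []

-- (a + x f)′ = f + x f′
deriv : Poly → Poly
deriv []      = []
deriv (a ∷ f) = f +ₚ (0ℚ ∷ deriv f)

D^ : ℕ → Poly → Poly
D^ zero    f = f
D^ (suc i) f = deriv (D^ i f)

module _ {q : Poly} {e : ℕ} (q-deg : HasDegree q e) where

  open HasDegree q-deg

  private
    instance
      lead≢0 : NonZero (coeff q e)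
      lead≢0 = ≢-nonZero leading≢0

  -- If r is the remainder of f, then a + x r has degree at most e, and
  -- subtracting from it a constant multiple of q gives the remainder of a + x f.
  remainder : Poly → Poly
  remainder []      = []
  remainder (a ∷ f) = (a ∷ r) +ₚ (- (coeff (a ∷ r) e ÷ coeff q e)) ·ₚ q
    where r = remainder f

_rem_[_] : (f q : Poly) {e : ℕ} → HasDegree q e → Poly
f rem q [ q-deg ] = remainder q-deg f

coeff-+ₚ : ∀ f g j → coeff (f +ₚ g) j ≡ coeff f j + coeff g j
coeff-+ₚ []      g       j       = sym (ℚ.+-identityˡ _)
coeff-+ₚ (a ∷ f) []      j       = sym (ℚ.+-identityʳ _)
coeff-+ₚ (a ∷ f) (b ∷ g) zero    = refl
coeff-+ₚ (a ∷ f) (b ∷ g) (suc j) = coeff-+ₚ f g j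

coeff-·ₚ : ∀ c f j → coeff (c ·ₚ f) j ≡ c * coeff f j
coeff-·ₚ c []      j       = sym (ℚ.*-zeroʳ c)
coeff-·ₚ c (a ∷ f) zero    = refl
coeff-·ₚ c (a ∷ f) (suc j) = coeff-·ₚ c f j

module _ {q : Poly} {e : ℕ} (q-deg : HasDegree q e) where

  open HasDegree q-deg
  open ≡-Reasoning

  private
    instance
      lead≢0 : NonZero (coeff q e)
      lead≢0 = ≢-nonZero leading≢0

  remainder-degree : ∀ f {j} → e ℕ.≤ j → coeff (f rem q [ q-deg ]) j ≡ 0ℚ
  remainder-degree []      _   = refl
  remainder-degree (a ∷ f) {j} e≤j = begin
    coeff ((a ∷ r) +ₚ (- c) ·ₚ q) j        ≡⟨ coeff-+ₚ (a ∷ r) ((- c) ·ₚ q) j ⟩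
    coeff (a ∷ r) j + coeff ((- c) ·ₚ q) j ≡⟨ cong (_+_ (coeff (a ∷ r) j)) (coeff-·ₚ (- c) q j) ⟩
    coeff (a ∷ r) j + (- c) * coeff q j    ≡⟨ case (ℕ.m≤n⇒m<n∨m≡n e≤j) ⟩
    0ℚ                                     ∎
    where
    open import Data.Sum.Base using (_⊎_; inj₁; inj₂)
    r = f rem q [ q-deg ]
    c = coeff (a ∷ r) e ÷ coeff q e

    high : ∀ {j} → e ℕ.< j → coeff (a ∷ r) j ≡ 0ℚ
    high (s≤s e≤j) = remainder-degree f e≤j

    case : e ℕ.< j ⊎ e ≡ j → coeff (a ∷ r) j + (- c) * coeff q j ≡ 0ℚ
    case (inj₁ e<j) = begin
      coeff (a ∷ r) j + (- c) * coeff q j ≡⟨ cong₂ (λ u v → u + (- c) * v) (high e<j) (above≡0 e<j) ⟩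
      0ℚ + (- c) * 0ℚ                     ≡⟨ cong (_+_ 0ℚ) (ℚ.*-zeroʳ (- c)) ⟩
      0ℚ                                  ∎
    case (inj₂ refl) = begin
      l + (- c) * coeff q e               ≡⟨ cong (_+_ l) (sym (ℚ.neg-distribˡ-* c (coeff q e))) ⟩
      l - c * coeff q e                   ≡⟨ cong (_-_ l) (ℚ.*-assoc l (1/ coeff q e) (coeff q e)) ⟩
      l - l * (1/ coeff q e * coeff q e)  ≡⟨ cong (λ u → l - l * u) (ℚ.*-inverseˡ (coeff q e)) ⟩
      l - l * 1ℚ                          ≡⟨ cong (_-_ l) (ℚ.*-identityʳ l) ⟩
      l - l                               ≡⟨ ℚ.+-inverseʳ l ⟩
      0ℚ                                  ∎
      where l = coeff (a ∷ r) e

  remainder-division : ∀ f → ∃ λ h → f ≈ₚ h *ₚ q +ₚ (f rem q [ q-deg ])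
  remainder-division []      = [] , λ _ → refl
  remainder-division (a ∷ f) with remainder-division f
  ... | h , f≈ = c ∷ h , λ j → sym (begin
    coeff ((c ·ₚ q +ₚ (0ℚ ∷ h *ₚ q)) +ₚ ((a ∷ r) +ₚ (- c) ·ₚ q)) j
      ≡⟨ coeff-+ₚ (c ·ₚ q +ₚ (0ℚ ∷ h *ₚ q)) ((a ∷ r) +ₚ (- c) ·ₚ q) j ⟩
    coeff (c ·ₚ q +ₚ (0ℚ ∷ h *ₚ q)) j + coeff ((a ∷ r) +ₚ (- c) ·ₚ q) j
      ≡⟨ cong₂ _+_ (coeff-+ₚ (c ·ₚ q) (0ℚ ∷ h *ₚ q) j) (coeff-+ₚ (a ∷ r) ((- c) ·ₚ q) j) ⟩
    (coeff (c ·ₚ q) j + s j) + (t j + coeff ((- c) ·ₚ q) j)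
      ≡⟨ cong₂ (λ u v → (u + s j) + (t j + v)) (coeff-·ₚ c q j)
           (trans (coeff-·ₚ (- c) q j) (sym (ℚ.neg-distribˡ-* c (coeff q j)))) ⟩
    (u j + s j) + (t j - u j)
      ≡⟨ cong (λ v → v + (t j - u j)) (ℚ.+-comm (u j) (s j)) ⟩
    (s j + u j) + (t j - u j)
      ≡⟨ ℚ.+-assoc (s j) (u j) (t j - u j) ⟩
    s j + (u j + (t j - u j))
      ≡⟨ cong (_+_ (s j)) (ℚ.+-comm (u j) (t j - u j)) ⟩
    s j + ((t j - u j) + u j)
      ≡⟨ cong (_+_ (s j)) (ℚ.+-assoc (t j) (- u j) (u j)) ⟩
    s j + (t j + (- u j + u j))
      ≡⟨ cong (λ v → s j + (t j + v)) (ℚ.+-inverseˡ (u j)) ⟩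
    s j + (t j + 0ℚ)
      ≡⟨ cong (_+_ (s j)) (ℚ.+-identityʳ (t j)) ⟩
    s j + t j
      ≡⟨ step j ⟩
    coeff (a ∷ f) j ∎)
    where
    r = f rem q [ q-deg ]
    c = coeff (a ∷ r) e ÷ coeff q e
    s t u : ℕ → ℚ
    s j = coeff (0ℚ ∷ h *ₚ q) j
    t j = coeff (a ∷ r) j
    u j = c * coeff q j

    step : ∀ j → s j + t j ≡ coeff (a ∷ f) j
    step zero    = ℚ.+-identityˡ a
    step (suc j) = trans (sym (coeff-+ₚ (h *ₚ q) r j)) (sym (f≈ j))

Ψ : ℕ → Poly
Ψ m = replicate m 1ℚ

Ψ-degree : ∀ m .{{_ : ℕ.NonZero m}} → HasDegree (Ψ m) (pred m)
Ψ-degree (suc n) = record { leading≢0 = λ eq → 1≢0 (trans (sym (lead n)) eq) ; above≡0 = above (suc n) }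
  where
  1≢0 : 1ℚ ≢ 0ℚ
  1≢0 ()

  lead : ∀ n → coeff (Ψ (suc n)) n ≡ 1ℚ
  lead zero    = refl
  lead (suc n) = lead n

  above : ∀ m {j} → pred m ℕ.< j → coeff (Ψ m) j ≡ 0ℚ
  above zero          _         = refl
  above (suc zero)    (s≤s _)   = refl
  above (suc (suc n)) (s≤s n<j) = above (suc n) n<j

f⟨_⟩ : (m : ℕ) .{{_ : ℕ.NonZero m}} → ℕ → Poly
f⟨ m ⟩ zero    = 1ℚ ∷ []
f⟨ m ⟩ (suc j) = (((- (+ 1 / m)) ·ₚ (X *ₚ deriv (Ψ m))) ^ₚ suc j) rem Ψ m [ Ψ-degree m ]

-- A ring homomorphism from ℚ exists, and is unique, exactly when the field has
-- characteristic zero. The apartness # plays the role of "different from", so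
-- that elements # 0# have inverses; ℂ and ℚ(e^{2πi/m}) are examples.
record ExtensionOfℚ (c ℓ₁ ℓ₂ : Level) : Set (lsuc (c ⊔ ℓ₁ ⊔ ℓ₂)) where
  field
    heytingField : HeytingField c ℓ₁ ℓ₂

  open HeytingField heytingField public
    renaming (_+_ to _+ᴷ_; _*_ to _*ᴷ_; _-_ to _-ᴷ_; -_ to -ᴷ_; refl to ≈-refl; sym to ≈-sym; trans to ≈-trans)

  commutativeRing : CommutativeRing c ℓ₁
  commutativeRing = record { isCommutativeRing = isCommutativeRing }

  open CommutativeRing commutativeRing public using (rawRing; semiring; +-monoid)
  open RawSemiringDefs (Semiring.rawSemiring semiring) public using () renaming (_^_ to _^ᴷ_)
  open RingMorphisms ℚ.+-*-rawRing rawRing using (IsRingHomomorphism)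

  field
    ι                    : ℚ → Carrier
    ι-isRingHomomorphism : IsRingHomomorphism ι

  open HCRProperties (HeytingField.heytingCommutativeRing heytingField)
    using (1#0; x-0≈x; x#0y#0→xy#0; invertibleˡ⇒#)
  open MonoidSum +-monoid using (sum-syntax)

  evalᴷ : Poly → Carrier → Carrier
  evalᴷ f x = foldr (λ a r → ι a +ᴷ x *ᴷ r) 0# f

  inv : ∀ {x} → x # 0# → Carrier
  inv x#0 = proj₁ (#⇒invertible x#0)

  inv-inverseˡ : ∀ {x} (x#0 : x # 0#) → inv x#0 *ᴷ x ≈ 1#
  inv-inverseˡ {x} x#0 with #⇒invertible x#0
  ... | _ , y[x-0]≈1 , _ = ≈-trans (*-congˡ (≈-sym (x-0≈x x))) y[x-0]≈1

  zpow : ∀ x → x # 0# → ℤ → Carrier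
  zpow x x#0 (+ n)    = x ^ᴷ n
  zpow x x#0 -[1+ n ] = inv x#0 ^ᴷ suc n

  ^-#0 : ∀ {x} → x # 0# → ∀ k → x ^ᴷ k # 0#
  ^-#0 x#0 zero    = 1#0
  ^-#0 x#0 (suc k) = x#0y#0→xy#0 x#0 (^-#0 x#0 k)

  #⇒-#0 : ∀ {x y} → x # y → x -ᴷ y # 0#
  #⇒-#0 {x} {y} x#y with #⇒invertible x#y
  ... | z , z[x-y]≈1 , _ = invertibleˡ⇒# (z , ≈-trans (*-congˡ (x-0≈x (x -ᴷ y))) z[x-y]≈1)

  -- In ℂ the root ξ = e^{2πi/m} is of this kind.
  record IsPrimitiveRoot (m : ℕ) (ξ : Carrier) : Set (ℓ₁ ⊔ ℓ₂) where
    field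
      ^m≈1 : ξ ^ᴷ m ≈ 1#
      ^s#1 : ∀ {s} → 0 ℕ.< s → s ℕ.< m → ξ ^ᴷ s # 1#

    root#0 : .{{_ : ℕ.NonZero m}} → ξ # 0#
    root#0 = helper m ^m≈1
      where
      helper : ∀ m .{{_ : ℕ.NonZero m}} → ξ ^ᴷ m ≈ 1# → ξ # 0#
      helper (suc n) ξⁿ⁺¹≈1 = invertibleˡ⇒#
        (ξ ^ᴷ n , ≈-trans (*-congˡ (x-0≈x ξ)) (≈-trans (*-comm (ξ ^ᴷ n) ξ) ξⁿ⁺¹≈1))

  -- m⁻¹ ∑_{s=1}^{m-1} p(ξˢ) ξ^{ns} / (1 - ξˢ)ᵏ, with s = suc (toℕ i).
  S : (m : ℕ) .{{_ : ℕ.NonZero m}} {ξ : Carrier} → IsPrimitiveRoot m ξ →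
      (k : ℕ) (p : Poly) → ℤ → Carrier
  S m {ξ} prim k p n = ι (+ 1 / m) *ᴷ (∑[ i < pred m ] summand (suc (toℕ i)) (s≤s z≤n) (bound i))
    where
    open IsPrimitiveRoot prim

    bound : (i : Fin (pred m)) → suc (toℕ i) ℕ.< m
    bound i = subst (suc (toℕ i) ℕ.<_) (ℕ.suc-pred m) (s≤s (toℕ<n i))

    summand : (s : ℕ) → 0 ℕ.< s → s ℕ.< m → Carrier
    summand s 0<s s<m =
      (evalᴷ p (ξ ^ᴷ s) *ᴷ zpow ξ root#0 (n ℤ.* + s)) *ᴷ inv denominator#0
      where
      denominator#0 : (1# -ᴷ ξ ^ᴷ s) ^ᴷ k # 0#
      denominator#0 = ^-#0 (#⇒-#0 (#-sym (^s#1 0<s s<m))) k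

{-# OPTIONS --safe #-}

-- At the nontrivial m-th roots of unity y the polynomial - x Ψ′ / m takes the
-- value z = 1 / (1 - y), so f_j takes the value zʲ there.  Let L(k, n, p) be the
-- sum with summands p(y) yⁿ zᵏ / m.  For k = 0 it is given by orthogonality of
-- characters as soon as deg p + n < m.  Since (1 - y) z = 1, one has
--   L(k+1, n+1, 1) = L(k+1, n, 1) - L(k, n, 1),
-- and L(k+1, 1, 1) = L(0, 1, f_{k+1}) = - f_{k+1}(1) / m because x f_{k+1} still
-- has degree < m; this determines all L(k, n, 1) with n < m + k.  Writing
-- p = p(1) - (1 - x) h then gives L(k+1, n, p) = p(1) L(k+1, n, 1) - L(k, n, h),
-- and passing from p to h shifts the Taylor coefficients of p at 1.

module Submission where

open import Defs
open import Algebra.Bundles using (CommutativeRing; CommutativeSemigroup)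
open import Algebra.Morphism.Structures using (module RingMorphisms)
import Algebra.Properties.CommutativeSemigroup as CommutativeSemigroupProperties
import Algebra.Properties.Semiring.Exp as SemiringExp
import Algebra.Properties.Semiring.Sum as SemiringSum
import Algebra.Solver.Ring as RingSolver
open import Algebra.Solver.Ring.AlmostCommutativeRing
  using (fromCommutativeRing; _-Raw-AlmostCommutative⟶_; Induced-equivalence)
open import Data.Bool.Base using (if_then_else_)
open import Data.Fin.Base using (Fin; zero; suc; toℕ)
open import Data.Fin.Properties using (toℕ<n)
open import Data.Integer.Base as ℤ using (ℤ; +_)
import Data.Integer.Properties as ℤ
open import Data.List.Base using ([]; _∷_)
open import Data.Maybe.Base using (just; nothing)
open import Data.Nat.Base as ℕ using (ℕ; zero; suc; _∸_; _≤_; _<_; z≤n; s≤s; _!)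
open import Data.Nat.Combinatorics using (_C_; nCk≡nC[n∸k]; nCn≡1; nCk+nC[k+1]≡[n+1]C[k+1])
import Data.Nat.Properties as ℕ
open import Data.Product.Base using (_×_; _,_)
open import Data.Rational.Base
  using (ℚ; 0ℚ; 1ℚ; _+_; _*_; _-_; -_; _/_; 1/_; _÷_; NonZero; ≢-nonZero; fromℚᵘ)
import Data.Rational.Properties as ℚ
open import Data.Rational.Solver using (module +-*-Solver)
import Data.Rational.Unnormalised.Base as ℚᵘ
import Data.Rational.Unnormalised.Properties as ℚᵘ
open import Level using (0ℓ)
open import Relation.Binary.Definitions using (WeaklyDecidable)
open import Relation.Binary.PropositionalEquality
  using (_≡_; refl; sym; trans; cong; cong₂; subst; module ≡-Reasoning)
open import Relation.Binary.PropositionalEquality.Algebra using (isMagma)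
import Relation.Binary.Reasoning.Setoid as SetoidReasoning
open import Relation.Nullary.Decidable using (yes; no; does)

-- Rational arithmetic, polynomials over ℚ and the closed forms.

module RationalPolynomials where

  open SemiringSum (CommutativeRing.semiring ℚ.+-*-commutativeRing)
  open ≡-Reasoning

  fromℚᵘ-homo-+ : ∀ p q → fromℚᵘ (p ℚᵘ.+ q) ≡ fromℚᵘ p + fromℚᵘ q
  fromℚᵘ-homo-+ p q = ℚ.toℚᵘ-injective (ℚᵘ.≃-trans (ℚ.toℚᵘ-fromℚᵘ (p ℚᵘ.+ q)) (ℚᵘ.≃-sym
    (ℚᵘ.≃-trans (ℚ.toℚᵘ-homo-+ (fromℚᵘ p) (fromℚᵘ q))
      (ℚᵘ.+-cong (ℚ.toℚᵘ-fromℚᵘ p) (ℚ.toℚᵘ-fromℚᵘ q)))))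

  fromℚᵘ-homo-* : ∀ p q → fromℚᵘ (p ℚᵘ.* q) ≡ fromℚᵘ p * fromℚᵘ q
  fromℚᵘ-homo-* p q = ℚ.toℚᵘ-injective (ℚᵘ.≃-trans (ℚ.toℚᵘ-fromℚᵘ (p ℚᵘ.* q)) (ℚᵘ.≃-sym
    (ℚᵘ.≃-trans (ℚ.toℚᵘ-homo-* (fromℚᵘ p) (fromℚᵘ q))
      (ℚᵘ.*-cong (ℚ.toℚᵘ-fromℚᵘ p) (ℚ.toℚᵘ-fromℚᵘ q)))))

  /1-homo-+ : ∀ a b → + (a ℕ.+ b) / 1 ≡ + a / 1 + + b / 1
  /1-homo-+ a b = trans
    (ℚ.fromℚᵘ-cong {ℚᵘ.mkℚᵘ (+ (a ℕ.+ b)) 0} {ℚᵘ.mkℚᵘ (+ a) 0 ℚᵘ.+ ℚᵘ.mkℚᵘ (+ b) 0}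
      (ℚᵘ.*≡* (cong (ℤ._* + 1) (trans (ℤ.pos-+ a b)
           (sym (cong₂ ℤ._+_ (ℤ.*-identityʳ (+ a)) (ℤ.*-identityʳ (+ b))))))))
    (fromℚᵘ-homo-+ (ℚᵘ.mkℚᵘ (+ a) 0) (ℚᵘ.mkℚᵘ (+ b) 0))

  -- Meant for `a = i + 1` and `b = i !`: it cancels the factor produced by differentiating against
  -- the factorial in a Taylor coefficient.
  1/[ab]*a : ∀ a b .{{_ : ℕ.NonZero a}} .{{_ : ℕ.NonZero b}} .{{_ : ℕ.NonZero (a ℕ.* b)}} →
             (+ 1 / (a ℕ.* b)) * (+ a / 1) ≡ + 1 / b
  1/[ab]*a (suc a) (suc b) = trans
    (sym (fromℚᵘ-homo-* (ℚᵘ.mkℚᵘ (+ 1) (b ℕ.+ a ℕ.* suc b)) (ℚᵘ.mkℚᵘ (+ suc a) 0)))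
    (ℚ.fromℚᵘ-cong {ℚᵘ.mkℚᵘ (+ 1) (b ℕ.+ a ℕ.* suc b) ℚᵘ.* ℚᵘ.mkℚᵘ (+ suc a) 0} {ℚᵘ.mkℚᵘ (+ 1) b}
      (ℚᵘ.*≡* (cong +_ eq)))
    where
    eq : (suc a ℕ.+ 0) ℕ.* suc b ≡ 1 ℕ.* (suc a ℕ.* suc b ℕ.* 1)
    eq = trans (cong (ℕ._* suc b) (ℕ.+-identityʳ (suc a)))
      (sym (trans (ℕ.*-identityˡ _) (ℕ.*-identityʳ _)))

  1/n*n : ∀ n .{{_ : ℕ.NonZero n}} → (+ 1 / n) * (+ n / 1) ≡ 1ℚ
  1/n*n (suc n) = trans
    (sym (fromℚᵘ-homo-* (ℚᵘ.mkℚᵘ (+ 1) n) (ℚᵘ.mkℚᵘ (+ suc n) 0)))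
    (ℚ.fromℚᵘ-cong {ℚᵘ.mkℚᵘ (+ 1) n ℚᵘ.* ℚᵘ.mkℚᵘ (+ suc n) 0} {ℚᵘ.1ℚᵘ}
      (ℚᵘ.*≡* (cong +_ (ℕ.*-assoc 1 (suc n) 1))))

  -- Evaluation, derivatives, division by 1 - x and Taylor coefficients at 1.

  eval-+ₚ : ∀ f g x → eval (f +ₚ g) x ≡ eval f x + eval g x
  eval-+ₚ []      g       x = sym (ℚ.+-identityˡ _)
  eval-+ₚ (a ∷ f) []      x = sym (ℚ.+-identityʳ _)
  eval-+ₚ (a ∷ f) (b ∷ g) x = trans (cong (λ e → a + b + x * e) (eval-+ₚ f g x))
    (solve 5 (λ a b x u v → a :+ b :+ x :* (u :+ v) := (a :+ x :* u) :+ (b :+ x :* v))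
         refl a b x (eval f x) (eval g x))
    where open +-*-Solver

  eval-vanishing : ∀ p x → (∀ j → coeff p j ≡ 0ℚ) → eval p x ≡ 0ℚ
  eval-vanishing []      x z = refl
  eval-vanishing (a ∷ p) x z = trans (cong₂ (λ u v → u + x * v) (z 0) (eval-vanishing p x (λ j → z (suc j))))
    (trans (ℚ.+-identityˡ _) (ℚ.*-zeroʳ x))

  +ₚ-identityʳ : ∀ f → f +ₚ [] ≡ f
  +ₚ-identityʳ []      = refl
  +ₚ-identityʳ (a ∷ f) = refl

  +ₚ-comm : ∀ f g → f +ₚ g ≡ g +ₚ f
  +ₚ-comm []      g       = sym (+ₚ-identityʳ g)
  +ₚ-comm (a ∷ f) []      = refl
  +ₚ-comm (a ∷ f) (b ∷ g) = cong₂ _∷_ (ℚ.+-comm a b) (+ₚ-comm f g)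

  +ₚ-assoc : ∀ f g h → (f +ₚ g) +ₚ h ≡ f +ₚ (g +ₚ h)
  +ₚ-assoc []      g       h       = refl
  +ₚ-assoc (a ∷ f) []      h       = refl
  +ₚ-assoc (a ∷ f) (b ∷ g) []      = refl
  +ₚ-assoc (a ∷ f) (b ∷ g) (c ∷ h) = cong₂ _∷_ (ℚ.+-assoc a b c) (+ₚ-assoc f g h)

  -- The laws hold for coefficient lists on the nose, trailing zeros included, so sums can be
  -- rearranged under `deriv` and `eval` by plain `cong`.
  +ₚ-commutativeSemigroup : CommutativeSemigroup 0ℓ 0ℓ
  +ₚ-commutativeSemigroup = record
    { isCommutativeSemigroup = record
      { isSemigroup = record { isMagma = isMagma _+ₚ_ ; assoc = +ₚ-assoc }
      ; comm        = +ₚ-comm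
      }
    }

  open CommutativeSemigroupProperties +ₚ-commutativeSemigroup using ()
    renaming (interchange to +ₚ-interchange)

  deriv-+ₚ : ∀ f g → deriv (f +ₚ g) ≡ deriv f +ₚ deriv g
  deriv-+ₚ []      g       = refl
  deriv-+ₚ (a ∷ f) []      = sym (+ₚ-identityʳ _)
  deriv-+ₚ (a ∷ f) (b ∷ g) = trans (cong (λ e → (f +ₚ g) +ₚ (0ℚ ∷ e)) (deriv-+ₚ f g))
    (+ₚ-interchange f g (0ℚ ∷ deriv f) (0ℚ ∷ deriv g))

  D^-+ₚ : ∀ i f g → D^ i (f +ₚ g) ≡ D^ i f +ₚ D^ i g
  D^-+ₚ zero    f g = refl
  D^-+ₚ (suc i) f g = trans (cong deriv (D^-+ₚ i f g)) (deriv-+ₚ (D^ i f) (D^ i g))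

  D^-deriv : ∀ i f → D^ i (deriv f) ≡ D^ (suc i) f
  D^-deriv zero    f = refl
  D^-deriv (suc i) f = cong deriv (D^-deriv i f)

  D^[] : ∀ i → D^ i [] ≡ []
  D^[] zero    = refl
  D^[] (suc i) = cong deriv (D^[] i)

  -- The Leibniz rule Dⁱ⁺¹(x f) = x Dⁱ⁺¹f + (i + 1) Dⁱf at x = 1; the constant `a` dies under the
  -- first derivative.
  eval-D^-∷ : ∀ i a f → eval (D^ (suc i) (a ∷ f)) 1ℚ
              ≡ eval (D^ (suc i) f) 1ℚ + (+ suc i / 1) * eval (D^ i f) 1ℚ
  eval-D^-∷ i a f = begin
    eval (D^ (suc i) (a ∷ f)) 1ℚ                   ≡⟨ cong (λ g → eval g 1ℚ) (sym (D^-deriv i (a ∷ f))) ⟩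
    eval (D^ i (f +ₚ (0ℚ ∷ deriv f))) 1ℚ           ≡⟨ cong (λ g → eval g 1ℚ) (D^-+ₚ i f (0ℚ ∷ deriv f)) ⟩
    eval (D^ i f +ₚ D^ i (0ℚ ∷ deriv f)) 1ℚ        ≡⟨ eval-+ₚ (D^ i f) (D^ i (0ℚ ∷ deriv f)) 1ℚ ⟩
    eval (D^ i f) 1ℚ + eval (D^ i (0ℚ ∷ deriv f)) 1ℚ ≡⟨ cong (_+_ (eval (D^ i f) 1ℚ)) (tail i) ⟩
    eval (D^ i f) 1ℚ + (eval (D^ (suc i) f) 1ℚ + (+ i / 1) * eval (D^ i f) 1ℚ)
      ≡⟨ solve 3 (λ x y n → x :+ (y :+ n :* x) := y :+ (con 1ℚ :+ n) :* x) refl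
           (eval (D^ i f) 1ℚ) (eval (D^ (suc i) f) 1ℚ) (+ i / 1) ⟩
    eval (D^ (suc i) f) 1ℚ + (1ℚ + + i / 1) * eval (D^ i f) 1ℚ
      ≡⟨ cong (λ n → eval (D^ (suc i) f) 1ℚ + n * eval (D^ i f) 1ℚ) (sym (/1-homo-+ 1 i)) ⟩
    eval (D^ (suc i) f) 1ℚ + (+ suc i / 1) * eval (D^ i f) 1ℚ ∎
    where
    open +-*-Solver
    -- Here `0ℚ ∷ deriv f` is x f′, so for i > 0 the lemma itself applies one order lower, to f′.
    tail : ∀ i → eval (D^ i (0ℚ ∷ deriv f)) 1ℚ ≡ eval (D^ (suc i) f) 1ℚ + (+ i / 1) * eval (D^ i f) 1ℚ
    tail zero    = solve 2 (λ x y → con 0ℚ :+ con 1ℚ :* x := x :+ con 0ℚ :* y)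
         refl (eval (deriv f) 1ℚ) (eval f 1ℚ)
    tail (suc i) = trans (eval-D^-∷ i 0ℚ (deriv f))
      (cong₂ (λ g h → eval g 1ℚ + (+ suc i / 1) * eval h 1ℚ) (D^-deriv (suc i) f) (D^-deriv i f))

  -- The quotient h in p = p(1) - (1 - x) h.
  quot₁ : Poly → Poly
  quot₁ []      = []
  quot₁ (a ∷ f) = f +ₚ quot₁ f

  -- Since x f = f - (1 - x) f, the quotient for a + x f is f plus the quotient for f.
  eval-quot₁ : ∀ p x → eval p x ≡ eval p 1ℚ - (1ℚ - x) * eval (quot₁ p) x
  eval-quot₁ []      x = solve 1 (λ x → con 0ℚ := con 0ℚ :- (con 1ℚ :- x) :* con 0ℚ) refl x
    where open +-*-Solver
  eval-quot₁ (a ∷ f) x = begin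
    a + x * eval f x
      ≡⟨ solve 3 (λ a x u → a :+ x :* u := a :+ (u :- (con 1ℚ :- x) :* u)) refl a x (eval f x) ⟩
    a + (eval f x - (1ℚ - x) * eval f x)
      ≡⟨ cong (λ u → a + (u - (1ℚ - x) * eval f x)) (eval-quot₁ f x) ⟩
    a + (eval f 1ℚ - (1ℚ - x) * eval (quot₁ f) x - (1ℚ - x) * eval f x)
      ≡⟨ solve 5 (λ a x u v w → a :+ (u :- (con 1ℚ :- x) :* v :- (con 1ℚ :- x) :* w)
                  := a :+ con 1ℚ :* u :- (con 1ℚ :- x) :* (w :+ v)) refl
           a x (eval f 1ℚ) (eval (quot₁ f) x) (eval f x) ⟩
    a + 1ℚ * eval f 1ℚ - (1ℚ - x) * (eval f x + eval (quot₁ f) x)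
      ≡⟨ cong (λ u → a + 1ℚ * eval f 1ℚ - (1ℚ - x) * u) (sym (eval-+ₚ f (quot₁ f) x)) ⟩
    a + 1ℚ * eval f 1ℚ - (1ℚ - x) * eval (f +ₚ quot₁ f) x ∎
    where open +-*-Solver

  -- The quotient has degree one less. The offset `n` is carried along because degree bounds are
  -- used in the form deg p + n < N, where a large `n` forces p = 0.
  coeff-quot₁ : ∀ {N n} p → (∀ j → suc N ≤ j ℕ.+ n → coeff p j ≡ 0ℚ) →
                ∀ j → N ≤ j ℕ.+ n → coeff (quot₁ p) j ≡ 0ℚ
  coeff-quot₁ []      v j N≤j = refl
  coeff-quot₁ (a ∷ f) v j N≤j = trans (coeff-+ₚ f (quot₁ f) j)
    (cong₂ _+_ (v (suc j) (s≤s N≤j)) (coeff-quot₁ f (λ i N<i → v (suc i) (ℕ.m≤n⇒m≤1+n N<i)) j N≤j))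

  -- In Dⁱ⁺¹ of p(1) + (x - 1) h only the i + 1 terms that differentiate x - 1 exactly once survive
  -- at 1. Induction over the coefficients stands in for the product rule.
  eval-D^-quot₁ : ∀ i p → eval (D^ (suc i) p) 1ℚ ≡ (+ suc i / 1) * eval (D^ i (quot₁ p)) 1ℚ
  eval-D^-quot₁ i []      = trans (cong (λ g → eval g 1ℚ) (D^[] (suc i)))
    (sym (trans (cong (λ g → (+ suc i / 1) * eval g 1ℚ) (D^[] i)) (ℚ.*-zeroʳ (+ suc i / 1))))
  eval-D^-quot₁ i (a ∷ f) = begin
    eval (D^ (suc i) (a ∷ f)) 1ℚ
      ≡⟨ eval-D^-∷ i a f ⟩
    eval (D^ (suc i) f) 1ℚ + n * eval (D^ i f) 1ℚ
      ≡⟨ cong (λ u → u + n * eval (D^ i f) 1ℚ) (eval-D^-quot₁ i f) ⟩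
    n * eval (D^ i (quot₁ f)) 1ℚ + n * eval (D^ i f) 1ℚ
      ≡⟨ solve 3 (λ n x y → n :* x :+ n :* y := n :* (y :+ x))
           refl n (eval (D^ i (quot₁ f)) 1ℚ) (eval (D^ i f) 1ℚ) ⟩
    n * (eval (D^ i f) 1ℚ + eval (D^ i (quot₁ f)) 1ℚ)
      ≡⟨ cong (n *_) (sym (eval-+ₚ (D^ i f) (D^ i (quot₁ f)) 1ℚ)) ⟩
    n * eval (D^ i f +ₚ D^ i (quot₁ f)) 1ℚ
      ≡⟨ cong (λ g → n * eval g 1ℚ) (sym (D^-+ₚ i f (quot₁ f))) ⟩
    n * eval (D^ i (f +ₚ quot₁ f)) 1ℚ ∎
    where
    open +-*-Solver
    n = + suc i / 1

  -- The coefficient of yⁱ in p(1 - y), that is, of (1 - x)ⁱ in the expansion of p at 1.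
  taylor : ℕ → Poly → ℚ
  taylor i p = ((- 1ℚ) ^ i * eval (D^ i p) 1ℚ) /! i

  taylor-zero : ∀ p → taylor 0 p ≡ eval p 1ℚ
  taylor-zero p = trans (ℚ.*-identityʳ _) (ℚ.*-identityˡ _)

  -- In powers of y = 1 - x, the equation p = p(1) - y h shifts coefficients by one and changes
  -- their sign.
  taylor-suc : ∀ i p → taylor (suc i) p ≡ - taylor i (quot₁ p)
  taylor-suc i p = begin
    (s * eval (D^ (suc i) p) 1ℚ) * r              ≡⟨ cong (λ e → (s * e) * r) (eval-D^-quot₁ i p) ⟩
    (- 1ℚ * (- 1ℚ) ^ i * (n * e)) * r
      ≡⟨ solve 4 (λ s n e r → :- con 1ℚ :* s :* (n :* e) :* r := :- (s :* e :* (r :* n)))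
           refl ((- 1ℚ) ^ i) n e r ⟩
    - ((- 1ℚ) ^ i * e * (r * n))                  ≡⟨ cong (λ u → - ((- 1ℚ) ^ i * e * u)) (1/[ab]*a (suc i) (i !)) ⟩
    - taylor i (quot₁ p)                          ∎
    where
    open +-*-Solver
    instance _ = i ℕ.!≢0
             _ = suc i ℕ.!≢0
    s = (- 1ℚ) ^ suc i
    n = + suc i / 1
    r = + 1 / (suc i !)
    e = eval (D^ i (quot₁ p)) 1ℚ

  -- Double sums, convolutions and binomial weights.

  ∑₊≤-cong : ∀ k {F G : ℕ → ℕ → ℚ} → (∀ i j → F i j ≡ G i j) → ∑₊≤ k F ≡ ∑₊≤ k G
  ∑₊≤-cong k F≡G = sum-cong-≗ {n = suc k} λ i → sum-cong-≗ {n = suc (k ∸ toℕ i)} λ j → F≡G (toℕ i) (toℕ j)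

  ∑₊≤-neg : ∀ k (F : ℕ → ℕ → ℚ) → ∑₊≤ k (λ i j → - F i j) ≡ - ∑₊≤ k F
  ∑₊≤-neg k F = trans
    (sum-cong-≗ {n = suc k} λ i → sum-neg {suc (k ∸ toℕ i)} (λ j → F (toℕ i) (toℕ j)))
    (sum-neg {suc k} (λ i → sum {suc (k ∸ toℕ i)} (λ j → F (toℕ i) (toℕ j))))
    where
    sum-neg : ∀ {n} (f : Fin n → ℚ) → sum (λ i → - f i) ≡ - sum f
    sum-neg {zero}  f = refl
    sum-neg {suc n} f = trans (cong (_+_ (- f zero)) (sum-neg (λ i → f (suc i)))) (sym (ℚ.neg-distrib-+ (f zero) _))

  convolution : (c φ : ℕ → ℚ) → ℕ → ℚ
  convolution c φ k = ∑[ j ≤ k ] (c (k ∸ toℕ j) * φ (toℕ j))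

  -- The hypotheses say that the generating function of `c′` is 1 - y times that of `c`; this factor
  -- passes to the product with the generating function of `φ`. The induction splits off the term j
  -- = 0, which shifts `φ`.
  convolution-difference : ∀ {c c′ : ℕ → ℚ} → c′ 0 ≡ c 0 → (∀ l → c′ (suc l) ≡ c (suc l) - c l) →
    ∀ φ k → convolution c′ φ (suc k) ≡ convolution c φ (suc k) - convolution c φ k
  convolution-difference {c} {c′} c′₀ c′₊ φ zero = trans
    (cong₂ (λ u v → u * φ 0 + (v * φ 1 + 0ℚ)) (c′₊ 0) c′₀)
    (solve 4 (λ a b x y → (b :- a) :* x :+ (a :* y :+ con 0ℚ)
       := (b :* x :+ (a :* y :+ con 0ℚ)) :- (a :* x :+ con 0ℚ)) refl (c 0) (c 1) (φ 0) (φ 1))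
    where open +-*-Solver
  convolution-difference {c} {c′} c′₀ c′₊ φ (suc k) = trans
    (cong₂ (λ u v → u * φ 0 + v) (c′₊ (suc k)) (convolution-difference {c} {c′} c′₀ c′₊ (λ j → φ (suc j)) k))
    (solve 5 (λ a b x u v → (b :- a) :* x :+ (u :- v) := (b :* x :+ u) :- (a :* x :+ v)) refl
       (c (suc k)) (c (suc (suc k))) (φ 0)
       (convolution c (λ j → φ (suc j)) (suc k)) (convolution c (λ j → φ (suc j)) k))
    where open +-*-Solver

  -- The coefficient of yˡ in (1 - y)ⁿ⁻¹.
  weight : ℕ → ℕ → ℚ
  weight zero    l = 1ℚ
  weight (suc n) l = (- 1ℚ) ^ l * (+ (n C l) / 1)

  weight-zero : ∀ n → weight n 0 ≡ 1ℚ
  weight-zero zero    = refl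
  weight-zero (suc n) = trans (ℚ.*-identityˡ _) (cong (λ c → + c / 1) (nC0≡1 n))
    where
    nC0≡1 : ∀ n → n C 0 ≡ 1
    nC0≡1 n = trans (nCk≡nC[n∸k] {k = 0} {n = n} z≤n) (nCn≡1 n)

  -- Pascal's rule is multiplication by 1 - y. At n = 0 it reads (1 - y) · 1/(1 - y) = 1.
  weight-pascal : ∀ n l → weight (suc n) (suc l) ≡ weight n (suc l) - weight n l
  weight-pascal zero    l = ℚ.*-zeroʳ ((- 1ℚ) ^ suc l)
  weight-pascal (suc n) l = begin
    - 1ℚ * s * (+ (suc n C suc l) / 1)
      ≡⟨ cong (λ c → - 1ℚ * s * (+ c / 1)) (sym (nCk+nC[k+1]≡[n+1]C[k+1] n l)) ⟩
    - 1ℚ * s * (+ (n C l ℕ.+ n C suc l) / 1)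
      ≡⟨ cong (λ c → - 1ℚ * s * c) (/1-homo-+ (n C l) (n C suc l)) ⟩
    - 1ℚ * s * (+ (n C l) / 1 + + (n C suc l) / 1)
      ≡⟨ solve 3 (λ s a b → :- con 1ℚ :* s :* (a :+ b) := :- con 1ℚ :* s :* b :- s :* a)
           refl s (+ (n C l) / 1) (+ (n C suc l) / 1) ⟩
    - 1ℚ * s * (+ (n C suc l) / 1) - s * (+ (n C l) / 1) ∎
    where
    open +-*-Solver
    s = (- 1ℚ) ^ l

  -- The weights have generating function (1 - y)⁰ = 1, the unit for convolution.
  convolution-weight-1 : ∀ φ k → convolution (weight 1) φ k ≡ φ k
  convolution-weight-1 φ zero    = trans (ℚ.+-identityʳ _) (ℚ.*-identityˡ (φ 0))
  convolution-weight-1 φ (suc k) = trans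
    (cong₂ (λ u v → u * φ 0 + v) (weight-pascal 0 k) (convolution-weight-1 (λ j → φ (suc j)) k))
    (trans (cong (λ u → u + φ (suc k)) (ℚ.*-zeroˡ (φ 0))) (ℚ.+-identityˡ _))

  -- For n < m, the average of yⁿ over all m-th roots of unity, y = 1 included.
  δ₀ : ℕ → ℚ
  δ₀ zero    = 1ℚ
  δ₀ (suc n) = 0ℚ

  -- Closed forms of the sums and their recursions, for arbitrary μ and φ.

  module Values (μ : ℚ) (φ : ℕ → ℚ) where

    -- The closed form of L(k, n, 1). The convolution is the coefficient of yᵏ in (1 - y)ⁿ⁻¹ Φ(y),
    -- with Φ the generating function of `φ`.
    value₁ : (k n : ℕ) → ℚ
    value₁ k n = δ₀ n - μ * convolution (weight n) φ k

    -- The closed form of L(k, n, p). The double sum is the coefficient of yᵏ in (1 - y)ⁿ⁻¹ p(1 - y)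
    -- Φ(y).
    value : (k n : ℕ) → Poly → ℚ
    value k n p = δ₀ n * eval p 0ℚ - μ * ∑₊≤ k (λ i j → weight n (k ∸ i ∸ j) * (taylor i p * φ j))

    value₁-1 : ∀ k → value₁ k 1 ≡ 0ℚ - μ * φ k
    value₁-1 k = cong (λ u → 0ℚ - μ * u) (convolution-weight-1 φ k)

    -- Raising n multiplies the weights by 1 - y. The two copies of `δ₀ n` on the right cancel, in
    -- accordance with `δ₀ (suc n)` being 0.
    value₁-suc : ∀ k n → value₁ (suc k) (suc n) ≡ value₁ (suc k) n - value₁ k n
    value₁-suc k n = trans
      (cong (λ u → 0ℚ - μ * u) (convolution-difference {weight n} {weight (suc n)}
        (trans (weight-zero (suc n)) (sym (weight-zero n))) (weight-pascal n) φ k))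
      (solve 4 (λ d m u v → con 0ℚ :- m :* (u :- v) := (d :- m :* u) :- (d :- m :* v)) refl
        (δ₀ n) μ (convolution (weight n) φ (suc k)) (convolution (weight n) φ k))
      where open +-*-Solver

    value-zero : φ 0 ≡ 1ℚ → ∀ n p → value 0 n p ≡ δ₀ n * eval p 0ℚ - μ * eval p 1ℚ
    value-zero φ₀ n p = cong (λ u → δ₀ n * eval p 0ℚ - μ * u) (trans
      (cong (λ u → u + 0ℚ + 0ℚ) (cong₂ _*_ (weight-zero n) (cong₂ _*_ (taylor-zero p) φ₀)))
      (solve 1 (λ x → con 1ℚ :* (x :* con 1ℚ) :+ con 0ℚ :+ con 0ℚ := x) refl (eval p 1ℚ)))
      where open +-*-Solver

    -- The row i = 0 gives p(1) times a convolution; by `taylor-suc` the rows i ≥ 1 form the negated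
    -- double sum of the quotient h, with k in place of k + 1. The boundary term splits through p(0)
    -- = p(1) - h(0).
    value-suc : ∀ k n p → value (suc k) n p ≡ eval p 1ℚ * value₁ (suc k) n - value k n (quot₁ p)
    value-suc k n p = begin
      d * eval p 0ℚ - μ * (row₀ + ∑₊≤ k (λ i j → weight n (k ∸ i ∸ j) * (taylor (suc i) p * φ j)))
        ≡⟨ cong₂ (λ u v → d * u - μ * v) (eval-quot₁ p 0ℚ) (cong₂ _+_ row₀≡ rows≡) ⟩
      d * (P - (1ℚ - 0ℚ) * Q) - μ * (P * C₀ + - Σ′)
        ≡⟨ solve 6 (λ d m P Q C₀ S → d :* (P :- (con 1ℚ :- con 0ℚ) :* Q) :- m :* (P :* C₀ :+ :- S)
             := P :* (d :- m :* C₀) :- (d :* Q :- m :* S)) refl d μ P Q C₀ Σ′ ⟩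
      P * value₁ (suc k) n - value k n (quot₁ p) ∎
      where
      open +-*-Solver
      d = δ₀ n
      P = eval p 1ℚ
      Q = eval (quot₁ p) 0ℚ
      C₀ = convolution (weight n) φ (suc k)
      Σ′ = ∑₊≤ k (λ i j → weight n (k ∸ i ∸ j) * (taylor i (quot₁ p) * φ j))
      row₀ = ∑[ j ≤ suc k ] (weight n (suc k ∸ toℕ j) * (taylor 0 p * φ (toℕ j)))

      row₀≡ : row₀ ≡ P * C₀
      row₀≡ = trans
        (sum-cong-≗ {n = suc (suc k)} λ j → trans (cong (λ t → weight n (suc k ∸ toℕ j) * (t * φ (toℕ j)))
             (taylor-zero p))
          (solve 3 (λ w t f → w :* (t :* f) := t :* (w :* f))
               refl (weight n (suc k ∸ toℕ j)) P (φ (toℕ j))))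
        (sym (*-distribˡ-sum {suc (suc k)} P (λ j → weight n (suc k ∸ toℕ j) * φ (toℕ j))))

      rows≡ : ∑₊≤ k (λ i j → weight n (k ∸ i ∸ j) * (taylor (suc i) p * φ j)) ≡ - Σ′
      rows≡ = trans
        (∑₊≤-cong k {λ i j → weight n (k ∸ i ∸ j) * (taylor (suc i) p * φ j)}
          {λ i j → - (weight n (k ∸ i ∸ j) * (taylor i (quot₁ p) * φ j))}
          (λ i j → trans (cong (λ t → weight n (k ∸ i ∸ j) * (t * φ j)) (taylor-suc i p))
          (solve 3 (λ w t f → w :* (:- t :* f) := :- (w :* (t :* f)))
               refl (weight n (k ∸ i ∸ j)) (taylor i (quot₁ p)) (φ j))))
        (∑₊≤-neg k (λ i j → weight n (k ∸ i ∸ j) * (taylor i (quot₁ p) * φ j)))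

open RationalPolynomials

-- Evaluation of rational polynomials in the extension field.

module Evaluation {c ℓ₁ ℓ₂} (K : ExtensionOfℚ c ℓ₁ ℓ₂) where

  open ExtensionOfℚ K
  open RingMorphisms.IsRingHomomorphism ι-isRingHomomorphism public
    using () renaming (⟦⟧-cong to ι-cong; +-homo to ι-+; *-homo to ι-*; -‿homo to ι-neg; 0#-homo to ι-0; 1#-homo to ι-1)
  open SetoidReasoning setoid
  open SemiringSum semiring public
  open SemiringExp semiring public hiding (_^_)

  -- Agrees with ι, but sends 0ℚ and 1ℚ to 0# and 1# on the nose, so that these
  -- are available as constants in ring normalisation.
  constant : ℚ → Carrier
  constant a = if does (a ℚ.≟ 0ℚ) then 0# else if does (a ℚ.≟ 1ℚ) then 1# else ι a

  constant≈ι : ∀ a → constant a ≈ ι a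
  constant≈ι a with a ℚ.≟ 0ℚ | a ℚ.≟ 1ℚ
  ... | yes refl | _        = ≈-sym ι-0
  ... | no _     | yes refl = ≈-sym ι-1
  ... | no _     | no _     = ≈-refl

  constant-morphism : ℚ.+-*-rawRing -Raw-AlmostCommutative⟶ fromCommutativeRing commutativeRing
  constant-morphism = record
    { ⟦_⟧    = constant
    ; +-homo = λ a b → ≈-trans (constant≈ι (a + b)) (≈-trans (ι-+ a b) (≈-sym (+-cong (constant≈ι a) (constant≈ι b))))
    ; *-homo = λ a b → ≈-trans (constant≈ι (a * b)) (≈-trans (ι-* a b) (≈-sym (*-cong (constant≈ι a) (constant≈ι b))))
    ; -‿homo = λ a → ≈-trans (constant≈ι (- a)) (≈-trans (ι-neg a) (≈-sym (-‿cong (constant≈ι a))))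
    ; 0-homo = ≈-refl
    ; 1-homo = ≈-refl
    }

  constant-≟ : WeaklyDecidable (Induced-equivalence constant-morphism)
  constant-≟ a b with a ℚ.≟ b
  ... | yes refl = just ≈-refl
  ... | no  _    = nothing

  module Solver = RingSolver ℚ.+-*-rawRing (fromCommutativeRing commutativeRing) constant-morphism constant-≟

  -ᴷ-homo : ∀ a b → ι (a - b) ≈ ι a -ᴷ ι b
  -ᴷ-homo a b = ≈-trans (ι-+ a (- b)) (+-congˡ (ι-neg b))

  evalᴷ-+ₚ : ∀ f g x → evalᴷ (f +ₚ g) x ≈ evalᴷ f x +ᴷ evalᴷ g x
  evalᴷ-+ₚ []      g       x = ≈-sym (+-identityˡ _)
  evalᴷ-+ₚ (a ∷ f) []      x = ≈-sym (+-identityʳ _)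
  evalᴷ-+ₚ (a ∷ f) (b ∷ g) x = ≈-trans (+-cong (ι-+ a b) (*-congˡ (evalᴷ-+ₚ f g x)))
    (solve 5 (λ a b x u v → a :+ b :+ x :* (u :+ v) := (a :+ x :* u) :+ (b :+ x :* v)) ≈-refl
      (ι a) (ι b) x (evalᴷ f x) (evalᴷ g x))
    where open Solver

  evalᴷ-0∷ : ∀ f x → evalᴷ (0ℚ ∷ f) x ≈ x *ᴷ evalᴷ f x
  evalᴷ-0∷ f x = ≈-trans (+-congʳ ι-0) (+-identityˡ _)

  evalᴷ-1∷ : ∀ f x → evalᴷ (1ℚ ∷ f) x ≈ 1# +ᴷ x *ᴷ evalᴷ f x
  evalᴷ-1∷ f x = +-congʳ ι-1

  evalᴷ-1 : ∀ x → evalᴷ (1ℚ ∷ []) x ≈ 1#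
  evalᴷ-1 x = ≈-trans (evalᴷ-1∷ [] x) (solve 1 (λ x → con 1ℚ :+ x :* con 0ℚ := con 1ℚ) ≈-refl x)
    where open Solver

  evalᴷ-X : ∀ x → evalᴷ X x ≈ x
  evalᴷ-X x = ≈-trans (evalᴷ-0∷ (1ℚ ∷ []) x) (≈-trans (*-congˡ (evalᴷ-1 x)) (*-identityʳ x))

  evalᴷ-·ₚ : ∀ a f x → evalᴷ (a ·ₚ f) x ≈ ι a *ᴷ evalᴷ f x
  evalᴷ-·ₚ a []      x = ≈-sym (zeroʳ (ι a))
  evalᴷ-·ₚ a (b ∷ f) x = ≈-trans (+-cong (ι-* a b) (*-congˡ (evalᴷ-·ₚ a f x)))
    (solve 4 (λ a b x u → a :* b :+ x :* (a :* u) := a :* (b :+ x :* u))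
         ≈-refl (ι a) (ι b) x (evalᴷ f x))
    where open Solver

  evalᴷ-*ₚ : ∀ f g x → evalᴷ (f *ₚ g) x ≈ evalᴷ f x *ᴷ evalᴷ g x
  evalᴷ-*ₚ []      g x = ≈-sym (zeroˡ _)
  evalᴷ-*ₚ (a ∷ f) g x = begin
    evalᴷ (a ·ₚ g +ₚ (0ℚ ∷ f *ₚ g)) x
      ≈⟨ evalᴷ-+ₚ (a ·ₚ g) (0ℚ ∷ f *ₚ g) x ⟩
    evalᴷ (a ·ₚ g) x +ᴷ evalᴷ (0ℚ ∷ f *ₚ g) x
      ≈⟨ +-cong (evalᴷ-·ₚ a g x) (≈-trans (evalᴷ-0∷ (f *ₚ g) x) (*-congˡ (evalᴷ-*ₚ f g x))) ⟩
    ι a *ᴷ evalᴷ g x +ᴷ x *ᴷ (evalᴷ f x *ᴷ evalᴷ g x)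
      ≈⟨ solve 4 (λ a g x f → a :* g :+ x :* (f :* g) := (a :+ x :* f) :* g) ≈-refl
           (ι a) (evalᴷ g x) x (evalᴷ f x) ⟩
    (ι a +ᴷ x *ᴷ evalᴷ f x) *ᴷ evalᴷ g x ∎
    where open Solver

  evalᴷ-^ₚ : ∀ f j x → evalᴷ (f ^ₚ j) x ≈ evalᴷ f x ^ᴷ j
  evalᴷ-^ₚ f zero    x = evalᴷ-1 x
  evalᴷ-^ₚ f (suc j) x = ≈-trans (evalᴷ-*ₚ f (f ^ₚ j) x) (*-congˡ (evalᴷ-^ₚ f j x))

  -- Each division step only adds a constant multiple of q, which vanishes at a root of q.
  evalᴷ-remainder : ∀ {q e} (q-deg : HasDegree q e) f x → evalᴷ q x ≈ 0# →
                    evalᴷ (f rem q [ q-deg ]) x ≈ evalᴷ f x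
  evalᴷ-remainder q-deg []      x q≈0 = ≈-refl
  evalᴷ-remainder {q} {e} q-deg (a ∷ f) x q≈0 = begin
    evalᴷ ((a ∷ r) +ₚ b ·ₚ q) x
      ≈⟨ evalᴷ-+ₚ (a ∷ r) (b ·ₚ q) x ⟩
    evalᴷ (a ∷ r) x +ᴷ evalᴷ (b ·ₚ q) x
      ≈⟨ +-cong (+-congˡ (*-congˡ (evalᴷ-remainder q-deg f x q≈0)))
           (≈-trans (evalᴷ-·ₚ b q x) (≈-trans (*-congˡ q≈0) (zeroʳ (ι b)))) ⟩
    evalᴷ (a ∷ f) x +ᴷ 0#
      ≈⟨ +-identityʳ _ ⟩
    evalᴷ (a ∷ f) x ∎
    where
    r = f rem q [ q-deg ]
    b = - ((coeff (a ∷ r) e ÷ coeff q e) {{≢-nonZero (HasDegree.leading≢0 q-deg)}})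

  evalᴷ-quot₁ : ∀ p x → evalᴷ p x ≈ ι (eval p 1ℚ) -ᴷ (1# -ᴷ x) *ᴷ evalᴷ (quot₁ p) x
  evalᴷ-quot₁ []      x = ≈-trans
    (solve 1 (λ x → con 0ℚ := con 0ℚ :- (con 1ℚ :- x) :* con 0ℚ) ≈-refl x) (+-congʳ (≈-sym ι-0))
    where open Solver
  evalᴷ-quot₁ (a ∷ f) x = begin
    ι a +ᴷ x *ᴷ evalᴷ f x
      ≈⟨ solve 3 (λ a x u → a :+ x :* u := a :+ (u :- (con 1ℚ :- x) :* u))
           ≈-refl (ι a) x (evalᴷ f x) ⟩
    ι a +ᴷ (evalᴷ f x -ᴷ (1# -ᴷ x) *ᴷ evalᴷ f x)
      ≈⟨ +-congˡ (+-congʳ (evalᴷ-quot₁ f x)) ⟩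
    ι a +ᴷ (ι (eval f 1ℚ) -ᴷ (1# -ᴷ x) *ᴷ evalᴷ (quot₁ f) x -ᴷ (1# -ᴷ x) *ᴷ evalᴷ f x)
      ≈⟨ solve 5 (λ a x u v w → a :+ (u :- (con 1ℚ :- x) :* v :- (con 1ℚ :- x) :* w)
                := a :+ u :- (con 1ℚ :- x) :* (w :+ v)) ≈-refl
         (ι a) x (ι (eval f 1ℚ)) (evalᴷ (quot₁ f) x) (evalᴷ f x) ⟩
    ι a +ᴷ ι (eval f 1ℚ) -ᴷ (1# -ᴷ x) *ᴷ (evalᴷ f x +ᴷ evalᴷ (quot₁ f) x)
      ≈⟨ +-cong (≈-trans (≈-sym (ι-+ a (eval f 1ℚ))) (ι-cong (cong (_+_ a) (sym (ℚ.*-identityˡ (eval f 1ℚ))))))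
           (-‿cong (*-congˡ (≈-sym (evalᴷ-+ₚ f (quot₁ f) x)))) ⟩
    ι (a + 1ℚ * eval f 1ℚ) -ᴷ (1# -ᴷ x) *ᴷ evalᴷ (f +ₚ quot₁ f) x ∎
    where open Solver

  -- Values of Ψ and its derivative, and sums of powers.

  evalᴷ-Ψ-1 : ∀ n → evalᴷ (Ψ n) 1# ≈ ι (+ n / 1)
  evalᴷ-Ψ-1 zero    = ≈-sym ι-0
  evalᴷ-Ψ-1 (suc n) = ≈-trans (+-congˡ (≈-trans (*-identityˡ _) (evalᴷ-Ψ-1 n)))
    (≈-trans (≈-sym (ι-+ 1ℚ (+ n / 1))) (ι-cong (sym (/1-homo-+ 1 n))))

  geometric-Ψ : ∀ n x → (1# -ᴷ x) *ᴷ evalᴷ (Ψ n) x ≈ 1# -ᴷ x ^ᴷ n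
  geometric-Ψ zero    x = solve 1 (λ x → (con 1ℚ :- x) :* con 0ℚ := con 1ℚ :- con 1ℚ) ≈-refl x
    where open Solver
  geometric-Ψ (suc n) x = begin
    (1# -ᴷ x) *ᴷ evalᴷ (Ψ (suc n)) x          ≈⟨ *-congˡ (evalᴷ-1∷ (Ψ n) x) ⟩
    (1# -ᴷ x) *ᴷ (1# +ᴷ x *ᴷ evalᴷ (Ψ n) x)
      ≈⟨ solve 2 (λ x u → (con 1ℚ :- x) :* (con 1ℚ :+ x :* u) := con 1ℚ :- x :+ x :* ((con 1ℚ :- x) :* u))
           ≈-refl x (evalᴷ (Ψ n) x) ⟩
    1# -ᴷ x +ᴷ x *ᴷ ((1# -ᴷ x) *ᴷ evalᴷ (Ψ n) x)  ≈⟨ +-congˡ (*-congˡ (geometric-Ψ n x)) ⟩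
    1# -ᴷ x +ᴷ x *ᴷ (1# -ᴷ x ^ᴷ n)
      ≈⟨ solve 2 (λ x u → con 1ℚ :- x :+ x :* (con 1ℚ :- u) := con 1ℚ :- x :* u) ≈-refl x (x ^ᴷ n) ⟩
    1# -ᴷ x ^ᴷ suc n ∎
    where open Solver

  -- The derivative of (1 - x) Ψₙ = 1 - xⁿ, multiplied by x so that no exponent n - 1 occurs. The
  -- induction uses Ψₙ₊₁ = 1 + x Ψₙ.
  deriv-Ψ : ∀ n x → (1# -ᴷ x) *ᴷ (x *ᴷ evalᴷ (deriv (Ψ n)) x)
                    ≈ x *ᴷ evalᴷ (Ψ n) x -ᴷ ι (+ n / 1) *ᴷ x ^ᴷ n
  deriv-Ψ zero    x = ≈-trans
    (solve 1 (λ x → (con 1ℚ :- x) :* (x :* con 0ℚ) := x :* con 0ℚ :- con 0ℚ :* con 1ℚ) ≈-refl x)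
    (+-congˡ (-‿cong (*-congʳ (≈-sym ι-0))))
    where open Solver
  deriv-Ψ (suc n) x = begin
    (1# -ᴷ x) *ᴷ (x *ᴷ evalᴷ (Ψ n +ₚ (0ℚ ∷ deriv (Ψ n))) x)
      ≈⟨ *-congˡ (*-congˡ (≈-trans (evalᴷ-+ₚ (Ψ n) (0ℚ ∷ deriv (Ψ n)) x)
           (+-congˡ (evalᴷ-0∷ (deriv (Ψ n)) x)))) ⟩
    (1# -ᴷ x) *ᴷ (x *ᴷ (u +ᴷ x *ᴷ v))
      ≈⟨ solve 3 (λ x u v → (con 1ℚ :- x) :* (x :* (u :+ x :* v)) := x :* ((con 1ℚ :- x) :* u :+ (con 1ℚ :- x) :* (x :* v)))
           ≈-refl x u v ⟩
    x *ᴷ ((1# -ᴷ x) *ᴷ u +ᴷ (1# -ᴷ x) *ᴷ (x *ᴷ v))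
      ≈⟨ *-congˡ (+-cong (geometric-Ψ n x) (deriv-Ψ n x)) ⟩
    x *ᴷ ((1# -ᴷ w) +ᴷ (x *ᴷ u -ᴷ ι (+ n / 1) *ᴷ w))
      ≈⟨ solve 4 (λ x u w n → x :* ((con 1ℚ :- w) :+ (x :* u :- n :* w))
           := x :* (con 1ℚ :+ x :* u) :- (con 1ℚ :+ n) :* (x :* w)) ≈-refl x u w (ι (+ n / 1)) ⟩
    x *ᴷ (1# +ᴷ x *ᴷ u) -ᴷ (1# +ᴷ ι (+ n / 1)) *ᴷ (x *ᴷ w)
      ≈⟨ +-cong (*-congˡ (≈-sym (evalᴷ-1∷ (Ψ n) x)))
           (-‿cong (*-congʳ (≈-trans (+-congʳ (≈-sym ι-1))
                (≈-trans (≈-sym (ι-+ 1ℚ (+ n / 1))) (ι-cong (sym (/1-homo-+ 1 n))))))) ⟩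
    x *ᴷ evalᴷ (Ψ (suc n)) x -ᴷ ι (+ suc n / 1) *ᴷ x ^ᴷ suc n ∎
    where
    open Solver
    u = evalᴷ (Ψ n) x
    v = evalᴷ (deriv (Ψ n)) x
    w = x ^ᴷ n

  sum-powers : ∀ n x → ∑[ i < n ] (x ^ᴷ suc (toℕ i)) ≈ x *ᴷ evalᴷ (Ψ n) x
  sum-powers zero    x = ≈-sym (zeroʳ x)
  sum-powers (suc n) x = begin
    x *ᴷ 1# +ᴷ ∑[ i < n ] (x *ᴷ x ^ᴷ suc (toℕ i)) ≈⟨ +-congˡ (≈-sym (*-distribˡ-sum {n} x (λ i → x ^ᴷ suc (toℕ i)))) ⟩
    x *ᴷ 1# +ᴷ x *ᴷ (∑[ i < n ] (x ^ᴷ suc (toℕ i))) ≈⟨ +-congˡ (*-congˡ (sum-powers n x)) ⟩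
    x *ᴷ 1# +ᴷ x *ᴷ (x *ᴷ evalᴷ (Ψ n) x)          ≈⟨ ≈-sym (distribˡ x 1# _) ⟩
    x *ᴷ (1# +ᴷ x *ᴷ evalᴷ (Ψ n) x)               ≈⟨ *-congˡ (≈-sym (evalᴷ-1∷ (Ψ n) x)) ⟩
    x *ᴷ evalᴷ (Ψ (suc n)) x ∎

  -- In a Heyting field, apartness of x and y supplies the inverse of x - y to cancel with.
  #-cancel : ∀ {x y z} → x # y → (x -ᴷ y) *ᴷ z ≈ 0# → z ≈ 0#
  #-cancel {x} {y} {z} x#y dz≈0 = begin
    z                              ≈⟨ ≈-sym (*-identityˡ z) ⟩
    1# *ᴷ z                        ≈⟨ *-congʳ (≈-sym (inv-inverseˡ d#0)) ⟩
    inv d#0 *ᴷ (x -ᴷ y) *ᴷ z       ≈⟨ *-assoc _ _ z ⟩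
    inv d#0 *ᴷ ((x -ᴷ y) *ᴷ z)     ≈⟨ *-congˡ dz≈0 ⟩
    inv d#0 *ᴷ 0#                  ≈⟨ zeroʳ _ ⟩
    0#                             ∎
    where d#0 = #⇒-#0 x#y

-- Sums over the nontrivial m-th roots of unity.

module Moments {c ℓ₁ ℓ₂} (K : ExtensionOfℚ c ℓ₁ ℓ₂) (N : ℕ)
  {ξ : ExtensionOfℚ.Carrier K} (prim : ExtensionOfℚ.IsPrimitiveRoot K (suc N) ξ) where

  open ExtensionOfℚ K
  open Evaluation K
  open IsPrimitiveRoot prim
  open SetoidReasoning setoid

  m : ℕ
  m = suc N

  μ : ℚ
  μ = + 1 / m

  φ : ℕ → ℚ
  φ j = eval (f⟨ m ⟩ j) 1ℚ

  open Values μ φ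

  power^m : ∀ s → (ξ ^ᴷ s) ^ᴷ m ≈ 1#
  power^m s = begin
    (ξ ^ᴷ s) ^ᴷ m     ≈⟨ ^-assocʳ ξ s m ⟩
    ξ ^ᴷ (s ℕ.* m)    ≈⟨ ^-congʳ ξ (ℕ.*-comm s m) ⟩
    ξ ^ᴷ (m ℕ.* s)    ≈⟨ ≈-sym (^-assocʳ ξ m s) ⟩
    (ξ ^ᴷ m) ^ᴷ s     ≈⟨ ^-congˡ s ^m≈1 ⟩
    1# ^ᴷ s           ≈⟨ 1^n≈1 s ⟩
    1#                ∎
    where
    1^n≈1 : ∀ n → 1# ^ᴷ n ≈ 1#
    1^n≈1 zero    = ≈-refl
    1^n≈1 (suc n) = ≈-trans (*-identityˡ _) (1^n≈1 n)

  Ψ-root : ∀ {s} → 0 < s → s < m → evalᴷ (Ψ m) (ξ ^ᴷ s) ≈ 0#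
  Ψ-root {s} 0<s s<m = #-cancel (#-sym (^s#1 0<s s<m))
    (≈-trans (geometric-Ψ m (ξ ^ᴷ s)) (≈-trans (+-congˡ (-‿cong (power^m s))) (-‿inverseʳ 1#)))

  root : Fin N → Carrier
  root i = ξ ^ᴷ suc (toℕ i)

  Ψ-root-i : ∀ i → evalᴷ (Ψ m) (root i) ≈ 0#
  Ψ-root-i i = Ψ-root (s≤s z≤n) (s≤s (toℕ<n i))

  -- Represents 1 / (1 - y) at the nontrivial roots y; its powers modulo `Ψ m` are the `f⟨ m ⟩ j`
  -- with j ≥ 1.
  inverse : Poly
  inverse = (- μ) ·ₚ (X *ₚ deriv (Ψ m))

  z : Fin N → Carrier
  z i = evalᴷ inverse (root i)

  -- As Ψ(y) = 0 and yᵐ = 1, `deriv-Ψ` leaves (1 - y) y Ψ′(y) = - m, which the factor - 1/m turns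
  -- into 1.
  z-inverse : ∀ i → (1# -ᴷ root i) *ᴷ z i ≈ 1#
  z-inverse i = begin
    (1# -ᴷ y) *ᴷ z i
      ≈⟨ *-congˡ (≈-trans (evalᴷ-·ₚ (- μ) (X *ₚ deriv (Ψ m)) y)
           (*-cong (ι-neg μ) (≈-trans (evalᴷ-*ₚ X (deriv (Ψ m)) y) (*-congʳ (evalᴷ-X y))))) ⟩
    (1# -ᴷ y) *ᴷ (-ᴷ ι μ *ᴷ (y *ᴷ v))
      ≈⟨ solve 3 (λ y u v → (con 1ℚ :- y) :* (:- u :* (y :* v)) := :- u :* ((con 1ℚ :- y) :* (y :* v)))
           ≈-refl y (ι μ) v ⟩
    -ᴷ ι μ *ᴷ ((1# -ᴷ y) *ᴷ (y *ᴷ v))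
      ≈⟨ *-congˡ (≈-trans (deriv-Ψ m y)
           (+-cong (*-congˡ (Ψ-root-i i)) (-‿cong (*-congˡ (power^m (suc (toℕ i))))))) ⟩
    -ᴷ ι μ *ᴷ (y *ᴷ 0# -ᴷ ι (+ m / 1) *ᴷ 1#)
      ≈⟨ solve 3 (λ y u n → :- u :* (y :* con 0ℚ :- n :* con 1ℚ) := u :* n)
           ≈-refl y (ι μ) (ι (+ m / 1)) ⟩
    ι μ *ᴷ ι (+ m / 1)
      ≈⟨ ≈-trans (≈-sym (ι-* μ (+ m / 1))) (≈-trans (ι-cong (1/n*n m)) ι-1) ⟩
    1# ∎
    where
    open Solver
    y = root i
    v = evalᴷ (deriv (Ψ m)) y

  evalᴷ-f : ∀ j i → evalᴷ (f⟨ m ⟩ j) (root i) ≈ z i ^ᴷ j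
  evalᴷ-f zero    i = evalᴷ-1 (root i)
  evalᴷ-f (suc j) i = ≈-trans
    (evalᴷ-remainder (Ψ-degree m) (inverse ^ₚ suc j) (root i) (Ψ-root-i i))
    (evalᴷ-^ₚ inverse (suc j) (root i))

  -- Moments, orthogonality and the recursions in k and n.

  term : (k n : ℕ) → Poly → Fin N → Carrier
  term k n p i = (evalᴷ p (root i) *ᴷ root i ^ᴷ n) *ᴷ z i ^ᴷ k

  -- This is L(k, n, p): multiplication by zᵏ replaces division by (1 - y)ᵏ.
  moment : (k n : ℕ) → Poly → Carrier
  moment k n p = ι μ *ᴷ sum (term k n p)

  one : Poly
  one = 1ℚ ∷ []

  -- Carries a linear relation between summands over to moments; the recursions below are obtained
  -- through it.
  sum-linear : ∀ {n} (f g h : Fin n → Carrier) a b → (∀ i → f i ≈ a *ᴷ g i +ᴷ b *ᴷ h i) →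
               ι μ *ᴷ sum f ≈ a *ᴷ (ι μ *ᴷ sum g) +ᴷ b *ᴷ (ι μ *ᴷ sum h)
  sum-linear {n} f g h a b f≈ = begin
    ι μ *ᴷ sum f
      ≈⟨ *-congˡ (≈-trans (sum-cong-≋ f≈) (≈-trans (∑-distrib-+ (λ i → a *ᴷ g i) (λ i → b *ᴷ h i))
           (≈-sym (+-cong (*-distribˡ-sum a g) (*-distribˡ-sum b h))))) ⟩
    ι μ *ᴷ (a *ᴷ sum g +ᴷ b *ᴷ sum h)
      ≈⟨ solve 5 (λ u a g b h → u :* (a :* g :+ b :* h) := a :* (u :* g) :+ b :* (u :* h))
           ≈-refl (ι μ) a (sum g) b (sum h) ⟩
    a *ᴷ (ι μ *ᴷ sum g) +ᴷ b *ᴷ (ι μ *ᴷ sum h) ∎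
    where open Solver

  -- Since (ξˢ)ⁿ = (ξⁿ)ˢ, this is a sum of powers wˢ over 1 ≤ s < m. The term for s = 0 completes it
  -- to Ψₘ(w), and its removal accounts for - μ.
  moment-0-one : ∀ {n} → n < m → moment 0 n one ≈ ι (δ₀ n - μ)
  moment-0-one {n} n<m = begin
    ι μ *ᴷ sum (term 0 n one)                ≈⟨ *-congˡ (sum-cong-≋ powers) ⟩
    ι μ *ᴷ ∑[ i < N ] (w ^ᴷ suc (toℕ i))     ≈⟨ *-congˡ (sum-powers N w) ⟩
    ι μ *ᴷ (w *ᴷ evalᴷ (Ψ N) w)
      ≈⟨ *-congˡ (solve 1 (λ x → x := (con 1ℚ :+ x) :- con 1ℚ) ≈-refl (w *ᴷ evalᴷ (Ψ N) w)) ⟩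
    ι μ *ᴷ (1# +ᴷ w *ᴷ evalᴷ (Ψ N) w -ᴷ 1#)  ≈⟨ *-congˡ (+-congʳ (≈-sym (evalᴷ-1∷ (Ψ N) w))) ⟩
    ι μ *ᴷ (evalᴷ (Ψ m) w -ᴷ 1#)             ≈⟨ distribˡ-minus ⟩
    ι μ *ᴷ evalᴷ (Ψ m) w -ᴷ ι μ              ≈⟨ +-congʳ (orthogonality n n<m) ⟩
    ι (δ₀ n) -ᴷ ι μ                          ≈⟨ ≈-sym (-ᴷ-homo (δ₀ n) μ) ⟩
    ι (δ₀ n - μ)                             ∎
    where
    open Solver
    w = ξ ^ᴷ n

    distribˡ-minus : ι μ *ᴷ (evalᴷ (Ψ m) w -ᴷ 1#) ≈ ι μ *ᴷ evalᴷ (Ψ m) w -ᴷ ι μ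
    distribˡ-minus = solve 2 (λ u x → u :* (x :- con 1ℚ) := u :* x :- u)
         ≈-refl (ι μ) (evalᴷ (Ψ m) w)

    powers : ∀ i → term 0 n one i ≈ w ^ᴷ suc (toℕ i)
    powers i = begin
      (evalᴷ one (root i) *ᴷ root i ^ᴷ n) *ᴷ 1# ≈⟨ ≈-trans (*-identityʳ _)
           (≈-trans (*-congʳ (evalᴷ-1 (root i))) (*-identityˡ _)) ⟩
      root i ^ᴷ n                               ≈⟨ ^-assocʳ ξ (suc (toℕ i)) n ⟩
      ξ ^ᴷ (suc (toℕ i) ℕ.* n)                  ≈⟨ ^-congʳ ξ (ℕ.*-comm (suc (toℕ i)) n) ⟩
      ξ ^ᴷ (n ℕ.* suc (toℕ i))                  ≈⟨ ≈-sym (^-assocʳ ξ n (suc (toℕ i))) ⟩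
      w ^ᴷ suc (toℕ i)                          ∎

    -- At n = 0 the point is 1, where Ψₘ has the value m; for 0 < n < m it is a root of Ψₘ.
    orthogonality : ∀ n → n < m → ι μ *ᴷ evalᴷ (Ψ m) (ξ ^ᴷ n) ≈ ι (δ₀ n)
    orthogonality zero    _   = ≈-trans (*-congˡ (evalᴷ-Ψ-1 m))
      (≈-trans (≈-sym (ι-* μ (+ m / 1))) (ι-cong (1/n*n m)))
    orthogonality (suc n) n<m = ≈-trans (*-congˡ (Ψ-root (s≤s z≤n) n<m)) (≈-trans (zeroʳ (ι μ)) (≈-sym ι-0))

  -- By linearity, a + x p at exponent n splits into a at exponent n and p at exponent n + 1. The
  -- hypothesis means deg p + n < m, which this shift preserves.
  moment-0 : ∀ n p → (∀ j → m ≤ j ℕ.+ n → coeff p j ≡ 0ℚ) →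
             moment 0 n p ≈ ι (δ₀ n * eval p 0ℚ - μ * eval p 1ℚ)
  moment-0 n []      v = begin
    moment 0 n []
      ≈⟨ sum-linear (term 0 n []) (term 0 n []) (term 0 n []) 0# 0# (λ i →
           solve 1 (λ y → (con 0ℚ :* y) :* con 1ℚ := con 0ℚ :* ((con 0ℚ :* y) :* con 1ℚ) :+ con 0ℚ :* ((con 0ℚ :* y) :* con 1ℚ))
                ≈-refl (root i ^ᴷ n)) ⟩
    0# *ᴷ moment 0 n [] +ᴷ 0# *ᴷ moment 0 n []
      ≈⟨ solve 1 (λ x → con 0ℚ :* x :+ con 0ℚ :* x := con 0ℚ) ≈-refl (moment 0 n []) ⟩
    0#
      ≈⟨ ≈-sym ι-0 ⟩
    ι 0ℚ
      ≈⟨ ι-cong (sym (cong₂ _-_ (ℚ.*-zeroʳ (δ₀ n)) (ℚ.*-zeroʳ μ))) ⟩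
    ι (δ₀ n * 0ℚ - μ * 0ℚ) ∎
    where open Solver
  moment-0 n (a ∷ p) v = begin
    moment 0 n (a ∷ p)
      ≈⟨ sum-linear (term 0 n (a ∷ p)) (term 0 n one) (term 0 (suc n) p) (ι a) 1# (λ i → ≈-trans
           (solve 4 (λ a y e w → ((a :+ y :* e) :* w) :* con 1ℚ := a :* ((con 1ℚ :* w) :* con 1ℚ) :+ con 1ℚ :* ((e :* (y :* w)) :* con 1ℚ))
             ≈-refl (ι a) (root i) (evalᴷ p (root i)) (root i ^ᴷ n))
           (+-congʳ (*-congˡ (*-congʳ (*-congʳ (≈-sym (evalᴷ-1 (root i)))))))) ⟩
    ι a *ᴷ moment 0 n one +ᴷ 1# *ᴷ moment 0 (suc n) p
      ≈⟨ +-cong constant-term (≈-trans (*-identityˡ _) (moment-0 (suc n) p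
           (λ j m≤ → v (suc j) (subst (m ≤_) (ℕ.+-suc j n) m≤)))) ⟩
    -- The factor `0ℚ` is `δ₀ (suc n)`.
    ι (a * (δ₀ n - μ)) +ᴷ ι (0ℚ * eval p 0ℚ - μ * eval p 1ℚ)
      ≈⟨ ≈-sym (ι-+ _ _) ⟩
    ι (a * (δ₀ n - μ) + (0ℚ * eval p 0ℚ - μ * eval p 1ℚ))
      ≈⟨ ι-cong (ℚ-solve 5 (λ a d u x y → a ⊗ (d ⊖ u) ⊕ (⟪ 0ℚ ⟫ ⊗ x ⊖ u ⊗ y) ⊜
           d ⊗ (a ⊕ ⟪ 0ℚ ⟫ ⊗ x) ⊖ u ⊗ (a ⊕ ⟪ 1ℚ ⟫ ⊗ y)) refl a (δ₀ n) μ (eval p 0ℚ) (eval p 1ℚ)) ⟩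
    ι (δ₀ n * eval (a ∷ p) 0ℚ - μ * eval (a ∷ p) 1ℚ) ∎
    where
    open Solver
    open +-*-Solver using () renaming (solve to ℚ-solve; _:*_ to _⊗_; _:+_ to _⊕_; _:-_ to _⊖_; con to ⟪_⟫; _:=_ to _⊜_)

    constant-term : ι a *ᴷ moment 0 n one ≈ ι (a * (δ₀ n - μ))
    -- Orthogonality covers n < m; for n ≥ m the hypothesis at j = 0 forces a = 0.
    constant-term with n ℕ.<? m
    ... | yes n<m = ≈-trans (*-congˡ (moment-0-one n<m)) (≈-sym (ι-* a (δ₀ n - μ)))
    ... | no  n≮m = begin
      ι a *ᴷ moment 0 n one ≈⟨ *-congʳ (≈-trans (ι-cong a≡0) ι-0) ⟩
      0# *ᴷ moment 0 n one  ≈⟨ zeroˡ _ ⟩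
      0#                    ≈⟨ ≈-sym ι-0 ⟩
      ι 0ℚ                  ≈⟨ ι-cong (sym (trans (cong (λ t → t * (δ₀ n - μ)) a≡0)
           (ℚ.*-zeroˡ (δ₀ n - μ)))) ⟩
      ι (a * (δ₀ n - μ))    ∎
      where
      a≡0 : a ≡ 0ℚ
      a≡0 = v 0 (ℕ.≮⇒≥ n≮m)

  -- At each root y z = z - 1, so one more factor y z turns into a difference.
  moment-suc-one : ∀ k n → moment (suc k) (suc n) one ≈ moment (suc k) n one -ᴷ moment k n one
  moment-suc-one k n = ≈-trans
    (sum-linear (term (suc k) (suc n) one) (term (suc k) n one) (term k n one) 1# (-ᴷ 1#) telescope)
    (solve 2 (λ x y → con 1ℚ :* x :+ :- con 1ℚ :* y := x :- y)
         ≈-refl (moment (suc k) n one) (moment k n one))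
    where
    open Solver
    telescope : ∀ i → term (suc k) (suc n) one i ≈ 1# *ᴷ term (suc k) n one i +ᴷ -ᴷ 1# *ᴷ term k n one i
    telescope i = begin
      (e *ᴷ (y *ᴷ w)) *ᴷ (z i *ᴷ v)
        ≈⟨ solve 5 (λ e y w z v → (e :* (y :* w)) :* (z :* v)
             := con 1ℚ :* (e :* w :* (z :* v)) :+ :- con 1ℚ :* (e :* w :* (((con 1ℚ :- y) :* z) :* v)))
                  ≈-refl e y w (z i) v ⟩
      1# *ᴷ (e *ᴷ w *ᴷ (z i *ᴷ v)) +ᴷ -ᴷ 1# *ᴷ (e *ᴷ w *ᴷ (((1# -ᴷ y) *ᴷ z i) *ᴷ v))
        ≈⟨ +-congˡ (*-congˡ (*-congˡ (≈-trans (*-congʳ (z-inverse i)) (*-identityˡ v)))) ⟩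
      1# *ᴷ (e *ᴷ w *ᴷ (z i *ᴷ v)) +ᴷ -ᴷ 1# *ᴷ (e *ᴷ w *ᴷ v) ∎
      where
      y = root i
      e = evalᴷ one y
      w = y ^ᴷ n
      v = z i ^ᴷ k

  -- Replacing zᵏ⁺¹ by the value of a remainder of degree < m - 1 reduces to the case k = 0. The
  -- factor y uses up the one degree left, and `δ₀ 1` being 0 removes the value of the remainder at
  -- 0.
  moment-suc-1-one : ∀ k → moment (suc k) 1 one ≈ ι (0ℚ - μ * φ (suc k))
  moment-suc-1-one k = begin
    moment (suc k) 1 one
      ≈⟨ *-congˡ (sum-cong-≋ λ i → begin
           (evalᴷ one (root i) *ᴷ root i ^ᴷ 1) *ᴷ z i ^ᴷ suc k
             ≈⟨ *-cong (*-congʳ (evalᴷ-1 (root i))) (≈-sym (evalᴷ-f (suc k) i)) ⟩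
           (1# *ᴷ root i ^ᴷ 1) *ᴷ evalᴷ (f⟨ m ⟩ (suc k)) (root i)
             ≈⟨ solve 2 (λ w e → (con 1ℚ :* w) :* e := (e :* w) :* con 1ℚ)
                  ≈-refl (root i ^ᴷ 1) (evalᴷ (f⟨ m ⟩ (suc k)) (root i)) ⟩
           (evalᴷ (f⟨ m ⟩ (suc k)) (root i) *ᴷ root i ^ᴷ 1) *ᴷ 1# ∎) ⟩
    moment 0 1 (f⟨ m ⟩ (suc k))
      ≈⟨ moment-0 1 (f⟨ m ⟩ (suc k)) (λ j m≤j+1 → remainder-degree (Ψ-degree m) (inverse ^ₚ suc k)
           (ℕ.≤-pred (subst (m ≤_) (ℕ.+-comm j 1) m≤j+1))) ⟩
    ι (0ℚ * eval (f⟨ m ⟩ (suc k)) 0ℚ - μ * φ (suc k))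
      ≈⟨ ι-cong (cong (λ t → t - μ * φ (suc k)) (ℚ.*-zeroˡ (eval (f⟨ m ⟩ (suc k)) 0ℚ))) ⟩
    ι (0ℚ - μ * φ (suc k)) ∎
    where open Solver

  moment-one : ∀ k n → n < m ℕ.+ k → moment k n one ≈ ι (value₁ k n)
  moment-one zero    n       n<m = ≈-trans (moment-0-one (subst (n <_) (ℕ.+-identityʳ m) n<m))
    (ι-cong (cong (λ t → δ₀ n - t) (sym (trans (cong (λ t → μ * (t * 1ℚ + 0ℚ)) (weight-zero n)) (ℚ.*-identityʳ μ)))))
  -- At n = 0 the recursion is read backwards, from the value already known at n = 1.
  moment-one (suc k) zero    _   = begin
    moment (suc k) 0 one
      ≈⟨ solve 2 (λ x y → x := (x :- y) :+ y) ≈-refl (moment (suc k) 0 one) (moment k 0 one) ⟩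
    moment (suc k) 0 one -ᴷ moment k 0 one +ᴷ moment k 0 one
      ≈⟨ +-cong (≈-sym (moment-suc-one k 0)) (moment-one k 0 (s≤s z≤n)) ⟩
    moment (suc k) 1 one +ᴷ ι (value₁ k 0)
      ≈⟨ +-congʳ (≈-trans (moment-suc-1-one k) (ι-cong (sym (value₁-1 (suc k))))) ⟩
    ι (value₁ (suc k) 1) +ᴷ ι (value₁ k 0)
      ≈⟨ ≈-sym (ι-+ _ _) ⟩
    ι (value₁ (suc k) 1 + value₁ k 0)
      ≈⟨ ι-cong (trans (cong (λ t → t + value₁ k 0) (value₁-suc k 0))
           (ℚ-solve 2 (λ x y → (x ⊖ y) ⊕ y ⊜ x) refl (value₁ (suc k) 0) (value₁ k 0))) ⟩
    ι (value₁ (suc k) 0) ∎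
    where
    open Solver
    open +-*-Solver using () renaming (solve to ℚ-solve; _:+_ to _⊕_; _:-_ to _⊖_; _:=_ to _⊜_)
  moment-one (suc k) (suc n) n<m = begin
    moment (suc k) (suc n) one                    ≈⟨ moment-suc-one k n ⟩
    moment (suc k) n one -ᴷ moment k n one
      ≈⟨ +-cong (moment-one (suc k) n (ℕ.<-trans (ℕ.n<1+n n) n<m))
           (-‿cong (moment-one k n (ℕ.≤-pred (subst (suc n <_) (ℕ.+-suc m k) n<m)))) ⟩
    ι (value₁ (suc k) n) -ᴷ ι (value₁ k n)        ≈⟨ ≈-sym (-ᴷ-homo _ _) ⟩
    ι (value₁ (suc k) n - value₁ k n)             ≈⟨ ι-cong (sym (value₁-suc k n)) ⟩
    ι (value₁ (suc k) (suc n))                    ∎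

  -- Insert p(y) = p(1) - (1 - y) h(y); in the second part 1 - y cancels one factor z.
  moment-suc : ∀ k n p → moment (suc k) n p ≈ ι (eval p 1ℚ) *ᴷ moment (suc k) n one -ᴷ moment k n (quot₁ p)
  moment-suc k n p = ≈-trans
    (sum-linear (term (suc k) n p) (term (suc k) n one) (term k n (quot₁ p)) (ι (eval p 1ℚ)) (-ᴷ 1#) split)
    (+-congˡ (solve 1 (λ x → :- con 1ℚ :* x := :- x) ≈-refl (moment k n (quot₁ p))))
    where
    open Solver
    split : ∀ i → term (suc k) n p i ≈ ι (eval p 1ℚ) *ᴷ term (suc k) n one i +ᴷ -ᴷ 1# *ᴷ term k n (quot₁ p) i
    split i = begin
      (evalᴷ p y *ᴷ w) *ᴷ (z i *ᴷ v)
        ≈⟨ *-congʳ (*-congʳ (evalᴷ-quot₁ p y)) ⟩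
      ((a -ᴷ (1# -ᴷ y) *ᴷ h) *ᴷ w) *ᴷ (z i *ᴷ v)
        ≈⟨ solve 6 (λ a y h w z v → ((a :- (con 1ℚ :- y) :* h) :* w) :* (z :* v)
             := a :* ((con 1ℚ :* w) :* (z :* v)) :+ :- con 1ℚ :* ((h :* w) :* (((con 1ℚ :- y) :* z) :* v)))
                  ≈-refl a y h w (z i) v ⟩
      a *ᴷ ((1# *ᴷ w) *ᴷ (z i *ᴷ v)) +ᴷ -ᴷ 1# *ᴷ ((h *ᴷ w) *ᴷ (((1# -ᴷ y) *ᴷ z i) *ᴷ v))
        ≈⟨ +-cong (*-congˡ (*-congʳ (*-congʳ (≈-sym (evalᴷ-1 y)))))
             (*-congˡ (*-congˡ (≈-trans (*-congʳ (z-inverse i)) (*-identityˡ v)))) ⟩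
      a *ᴷ ((evalᴷ one y *ᴷ w) *ᴷ (z i *ᴷ v)) +ᴷ -ᴷ 1# *ᴷ ((h *ᴷ w) *ᴷ v) ∎
      where
      y = root i
      a = ι (eval p 1ℚ)
      h = evalᴷ (quot₁ p) y
      w = y ^ᴷ n
      v = z i ^ᴷ k

  -- The hypothesis means deg p + n < m + k. It survives the induction on k because the quotient
  -- loses one degree as k drops by one.
  moment≈value : ∀ k n p → (∀ j → m ℕ.+ k ≤ j ℕ.+ n → coeff p j ≡ 0ℚ) → moment k n p ≈ ι (value k n p)
  moment≈value zero    n p vanish = ≈-trans
    (moment-0 n p (λ j m≤ → vanish j (subst (_≤ j ℕ.+ n) (sym (ℕ.+-identityʳ m)) m≤)))
    (ι-cong (sym (value-zero refl n p)))
  moment≈value (suc k) n p vanish = begin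
    moment (suc k) n p
      ≈⟨ moment-suc k n p ⟩
    ι (eval p 1ℚ) *ᴷ moment (suc k) n one -ᴷ moment k n (quot₁ p)
      ≈⟨ +-cong value-at-1 (-‿cong (moment≈value k n (quot₁ p) (coeff-quot₁ p
           (λ j m+k<j+n → vanish j (subst (_≤ j ℕ.+ n) (sym (ℕ.+-suc m k)) m+k<j+n))))) ⟩
    ι (eval p 1ℚ * value₁ (suc k) n) -ᴷ ι (value k n (quot₁ p))
      ≈⟨ ≈-sym (-ᴷ-homo _ _) ⟩
    ι (eval p 1ℚ * value₁ (suc k) n - value k n (quot₁ p))
      ≈⟨ ι-cong (sym (value-suc k n p)) ⟩
    ι (value (suc k) n p) ∎
    where
    value-at-1 : ι (eval p 1ℚ) *ᴷ moment (suc k) n one ≈ ι (eval p 1ℚ * value₁ (suc k) n)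
    -- Outside the range of `moment-one` the hypothesis makes every coefficient of p zero, so both
    -- sides carry the factor p(1) = 0.
    value-at-1 with n ℕ.<? m ℕ.+ suc k
    ... | yes n< = ≈-trans (*-congˡ (moment-one (suc k) n n<))
         (≈-sym (ι-* (eval p 1ℚ) (value₁ (suc k) n)))
    ... | no  n≮ = begin
      ι (eval p 1ℚ) *ᴷ moment (suc k) n one ≈⟨ *-congʳ (≈-trans (ι-cong p₁≡0) ι-0) ⟩
      0# *ᴷ moment (suc k) n one            ≈⟨ zeroˡ _ ⟩
      0#                                    ≈⟨ ≈-sym ι-0 ⟩
      ι 0ℚ                                  ≈⟨ ι-cong (sym (trans (cong (λ t → t * value₁ (suc k) n) p₁≡0)
           (ℚ.*-zeroˡ (value₁ (suc k) n)))) ⟩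
      ι (eval p 1ℚ * value₁ (suc k) n)      ∎
      where
      p₁≡0 : eval p 1ℚ ≡ 0ℚ
      p₁≡0 = eval-vanishing p 1ℚ (λ j → vanish j (ℕ.≤-trans (ℕ.≮⇒≥ n≮) (ℕ.m≤n+m n j)))

  -- From the sums S to moments, and the two formulas.

  inv-denominator : ∀ k i (d#0 : (1# -ᴷ root i) ^ᴷ k # 0#) → inv d#0 ≈ z i ^ᴷ k
  inv-denominator k i d#0 = begin
    -- Inverses are unique, so the result is the same for every apartness proof `d#0`, in particular
    -- for the one built inside `S`.
    inv d#0                                  ≈⟨ ≈-sym (*-identityʳ _) ⟩
    inv d#0 *ᴷ 1#                            ≈⟨ *-congˡ (≈-sym (power-inverse k)) ⟩
    inv d#0 *ᴷ (d ^ᴷ k *ᴷ z i ^ᴷ k)          ≈⟨ ≈-sym (*-assoc _ _ _) ⟩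
    inv d#0 *ᴷ d ^ᴷ k *ᴷ z i ^ᴷ k            ≈⟨ *-congʳ (inv-inverseˡ d#0) ⟩
    1# *ᴷ z i ^ᴷ k                           ≈⟨ *-identityˡ _ ⟩
    z i ^ᴷ k                                 ∎
    where
    open Solver
    d = 1# -ᴷ root i

    power-inverse : ∀ k → d ^ᴷ k *ᴷ z i ^ᴷ k ≈ 1#
    power-inverse zero    = *-identityˡ 1#
    power-inverse (suc k) = begin
      (d *ᴷ d ^ᴷ k) *ᴷ (z i *ᴷ z i ^ᴷ k)
        ≈⟨ solve 4 (λ d u z v → (d :* u) :* (z :* v) := (d :* z) :* (u :* v))
             ≈-refl d (d ^ᴷ k) (z i) (z i ^ᴷ k) ⟩
      (d *ᴷ z i) *ᴷ (d ^ᴷ k *ᴷ z i ^ᴷ k) ≈⟨ *-cong (z-inverse i) (power-inverse k) ⟩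
      1# *ᴷ 1#                           ≈⟨ *-identityˡ 1# ⟩
      1#                                 ∎

  zpow-pos : ∀ n i → zpow ξ root#0 (+ n ℤ.* + suc (toℕ i)) ≈ root i ^ᴷ n
  zpow-pos n i = begin
    zpow ξ root#0 (+ n ℤ.* + suc (toℕ i))  ≡⟨ cong (zpow ξ root#0) (sym (ℤ.pos-* n (suc (toℕ i)))) ⟩
    ξ ^ᴷ (n ℕ.* suc (toℕ i))               ≈⟨ ^-congʳ ξ (ℕ.*-comm n (suc (toℕ i))) ⟩
    ξ ^ᴷ (suc (toℕ i) ℕ.* n)               ≈⟨ ≈-sym (^-assocʳ ξ (suc (toℕ i)) n) ⟩
    root i ^ᴷ n                            ∎

  S≈moment : ∀ k n p → S m prim k p (+ n) ≈ moment k n p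
  S≈moment k n p = *-congˡ (sum-cong-≋ {N} (λ i → *-cong (*-congˡ (zpow-pos n i))
       (inv-denominator k i _)))

  S≈value : ∀ k n p d → HasDegree p d → d ℕ.+ n < m ℕ.+ k → S m prim k p (+ n) ≈ ι (value k n p)
  S≈value k n p d p-deg d+n<m+k = ≈-trans (S≈moment k n p) (moment≈value k n p (λ j m+k≤j+n →
    HasDegree.above≡0 p-deg (ℕ.+-cancelʳ-< n d j (ℕ.<-≤-trans d+n<m+k m+k≤j+n))))

  -- At n = 0 the weights are the coefficients of 1/(1 - y), all equal to 1, and `δ₀ 0` keeps the
  -- term p(0).
  S-0 : ∀ k p d → HasDegree p d → d < m ℕ.+ k →
        S m prim k p (+ 0) ≈ ι (eval p 0ℚ - μ * ∑₊≤ k (λ i j → taylor i p * φ j))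
  S-0 k p d p-deg d<m+k = ≈-trans
    (S≈value k 0 p d p-deg (subst (_< m ℕ.+ k) (sym (ℕ.+-identityʳ d)) d<m+k))
    (ι-cong (cong₂ (λ u v → u - μ * v) (ℚ.*-identityˡ (eval p 0ℚ))
      (∑₊≤-cong k {λ i j → 1ℚ * (taylor i p * φ j)} {λ i j → taylor i p * φ j}
           (λ i j → ℚ.*-identityˡ (taylor i p * φ j)))))

  -- The exponent is n + 1, so the weights are the signed binomials of (1 - y)ⁿ and the term p(0)
  -- drops out.
  S-pos : ∀ k p d n → HasDegree p d → d ℕ.+ suc n < m ℕ.+ k →
          S m prim k p (+ suc n) ≈ ι (- (μ * ∑₊≤ k (λ i j →
            (- 1ℚ) ^ (k ∸ i ∸ j) * taylor i p * φ j * (+ (n C (k ∸ i ∸ j)) / 1))))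
  S-pos k p d n p-deg d+n<m+k = ≈-trans (S≈value k (suc n) p d p-deg d+n<m+k)
    (ι-cong (trans (cong₂ (λ u v → u - μ * v) (ℚ.*-zeroˡ (eval p 0ℚ)) (∑₊≤-cong k {F} {G} rearrange))
         (ℚ.+-identityˡ _)))
    where
    open +-*-Solver
    F G : ℕ → ℕ → ℚ
    F i j = weight (suc n) (k ∸ i ∸ j) * (taylor i p * φ j)
    G i j = (- 1ℚ) ^ (k ∸ i ∸ j) * taylor i p * φ j * (+ (n C (k ∸ i ∸ j)) / 1)
    rearrange : ∀ i j → F i j ≡ G i j
    rearrange i j = solve 4 (λ s c t f → s :* c :* (t :* f) := s :* t :* f :* c) refl
      ((- 1ℚ) ^ (k ∸ i ∸ j)) (+ (n C (k ∸ i ∸ j)) / 1) (taylor i p) (φ j)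

theorem6p5 : ∀ {c ℓ₁ ℓ₂} (K : ExtensionOfℚ c ℓ₁ ℓ₂) → let open ExtensionOfℚ K in
    (k m : ℕ) .{{_ : ℕ.NonZero m}} {ξ : Carrier} (prim : IsPrimitiveRoot m ξ)
    (p : Poly) (d : ℕ) → HasDegree p d → d < m ℕ.+ k →
    (S m prim k p (+ 0)
    ≈ ι (eval p 0ℚ - (+ 1 / m) * ∑₊≤ k (λ i j →
    (((- 1ℚ) ^ i * eval (D^ i p) 1ℚ) /! i) * eval (f⟨ m ⟩ j) 1ℚ)))
    ×
    ((δ : ℤ) →
    (∀ x .{{_ : NonZero x}} →
    eval p (1/ x) ≡ ((- 1ℚ) ^ℤ (ℤ.- δ)) * (x ^ℤ (ℤ.- (+ d))) * eval p x) →
    (n : ℕ) → 1 ≤ n → n < (m ℕ.+ k) ∸ d →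
    S m prim k p (+ n)
    ≈ ι (- ((+ 1 / m) * ∑₊≤ k (λ i j →
    (- 1ℚ) ^ (k ∸ i ∸ j)
    * (((- 1ℚ) ^ i * eval (D^ i p) 1ℚ) /! i) * eval (f⟨ m ⟩ j) 1ℚ
    * (+ ((n ∸ 1) C (k ∸ i ∸ j)) / 1)))))
theorem6p5 K k (suc N) prim p d p-deg d<m+k =
  S-0 k p d p-deg d<m+k ,
  -- The bound with truncated subtraction becomes d + n < m + k by contraposition; matching on
  -- `suc n` makes n - 1 the upper index of the binomials.
  λ { _ _ (suc n) _ n<m+k∸d → S-pos k p d n p-deg (ℕ.≰⇒> λ m+k≤d+n →
        ℕ.<⇒≱ n<m+k∸d (ℕ.m≤n+o⇒m∸n≤o (suc N ℕ.+ k) d m+k≤d+n)) }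
  where open Moments K N prim
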